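{- Let $G$ be a twin-free, connected proper circular-arc graph. (1) If $\overline{G}$ is non-bipartite, then $\mathcal{N}[G]$ has, up to reversal, a unique arc ordering. (2) If $\overline{G}$ is bipartite and connected, then $\mathcal{N}[G]$ has, up to reversal, exactly two tight arc orderings.
   Context: Vertices $u\ne v$ of $G$ are twins if $N[u]=N[v]$ (closed neighborhoods); $G$ is twin-free if it has none. $\mathcal{N}[G]$ is the hypergraph on $V=V(G)$ with hyperedges $N[v]$, $v\in V$. A PCA graph is one having a representation by arcs of a circle, adjacency meaning intersection, in which no arc is contained in another. An arc ordering of a hypergraph on $V$ is a circular ordering of $V$ in which every hyperedge is a set of circularly consecutive vertices (an arc); it is tight if for any hyperedges $A,B$ with $\emptyset\neq A\subseteq B\neq V$ the arcs $A,B$ share an endpoint. Up to reversal means up to reversing the circular order.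
   Formalization: Part (2) is stated for graphs with at least two vertices, because the one-vertex graph meets all its hypotheses but has only one circular ordering, so "exactly two tight arc orderings" fails for it. -}

module Defs where

open import Level using (0ℓ)
open import Data.Bool using (Bool; true; false)
open import Data.Nat using (ℕ; zero; suc; _+_; _≤_; _<_)
open import Data.Nat.DivMod using (_mod_)
open import Data.Fin using (Fin; toℕ)
open import Data.Product using (Σ; ∃; ∃-syntax; _×_; _,_)
open import Data.Sum using (_⊎_)
open import Data.Empty using (⊥)
open import Relation.Nullary using (¬_)
open import Relation.Binary.PropositionalEquality using (_≡_; _≢_)
open import Function.Bundles using (_⇔_; _↔_; Inverse)

record Graph (n : ℕ) : Set where
  field
    adj    : Fin n → Fin n → Bool
    sym    : ∀ u v → adj u v ≡ adj v u
    irrefl : ∀ v → adj v v ≡ false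

open Graph public

Adj : ∀ {n} → Graph n → Fin n → Fin n → Set
Adj G u v = adj G u v ≡ true

CoAdj : ∀ {n} → Graph n → Fin n → Fin n → Set
CoAdj G u v = u ≢ v × adj G u v ≡ false

N[_]_ : ∀ {n} → Fin n → Graph n → Fin n → Set
(N[ v ] G) w = w ≡ v ⊎ Adj G v w

TwinFree : ∀ {n} → Graph n → Set
TwinFree G = ∀ u v → u ≢ v → ¬ (∀ w → (N[ u ] G) w ⇔ (N[ v ] G) w)

data Reach {n} (R : Fin n → Fin n → Set) : Fin n → Fin n → Set where
  here : ∀ {u} → Reach R u u
  step : ∀ {u w v} → R u w → Reach R w v → Reach R u v

Connected : ∀ {n} → (Fin n → Fin n → Set) → Set
Connected R = ∀ u v → Reach R u v

Bipartite : ∀ {n} → (Fin n → Fin n → Set) → Set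
Bipartite {n} R = Σ (Fin n → Bool) λ c → ∀ u v → R u v → c u ≢ c v

-- Circularly consecutive sets of positions 0,1,…,m-1 (arranged on a circle):
-- an interval [a,b) or the complement of one (covers ∅ and the full set).

InInterval : ∀ {m} → ℕ → ℕ → Fin m → Set
InInterval a b i = a ≤ toℕ i × toℕ i < b

IsArc : (m : ℕ) → (Fin m → Set) → Set
IsArc m P = ∃[ a ] ∃[ b ] (a ≤ b × b ≤ m ×
  ((∀ i → P i ⇔ InInterval a b i) ⊎ (∀ i → P i ⇔ (¬ InInterval a b i))))

sucC : ∀ {m} → Fin m → Fin m
sucC {suc k} i = suc (toℕ i) mod suc k

predC : ∀ {m} → Fin m → Fin m
predC {suc k} i = (toℕ i + k) mod suc k

Endpoint : ∀ {m} → (Fin m → Set) → Fin m → Set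
Endpoint P i = P i × (¬ P (predC i) ⊎ ¬ P (sucC i))

-- Proper circular-arc graphs.
-- Model of the circle: m points 0,…,m-1 in cyclic order (any finite family
-- of arcs of a real circle is combinatorially equivalent to one of these).

PCA : ∀ {n} → Graph n → Set₁
PCA {n} G = ∃[ m ] Σ (Fin n → Fin m → Set) λ A →
    (∀ v → IsArc m (A v))
  × (∀ v → ∃[ p ] A v p)
  × (∀ u v → u ≢ v → (Adj G u v ⇔ (∃[ p ] (A u p × A v p))))
  × (∀ u v → u ≢ v → ¬ (∀ p → A u p → A v p))

-- Circular orderings of V = Fin n: a bijection σ from vertices to positions
-- 0,…,n-1 (read cyclically).

CircOrd : ℕ → Set
CircOrd n = Fin n ↔ Fin n

posSet : ∀ {n} → CircOrd n → (Fin n → Set) → Fin n → Set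
posSet σ H p = H (Inverse.from σ p)

succV : ∀ {n} → CircOrd n → Fin n → Fin n
succV σ u = Inverse.from σ (sucC (Inverse.to σ u))

predV : ∀ {n} → CircOrd n → Fin n → Fin n
predV σ u = Inverse.from σ (predC (Inverse.to σ u))

SameUpToReversal : ∀ {n} → CircOrd n → CircOrd n → Set
SameUpToReversal σ τ =
  (∀ u → succV τ u ≡ succV σ u) ⊎ (∀ u → succV τ u ≡ predV σ u)

ArcOrdering : ∀ {n} → Graph n → CircOrd n → Set
ArcOrdering {n} G σ = ∀ v → IsArc n (posSet σ (N[ v ] G))

TightArcOrdering : ∀ {n} → Graph n → CircOrd n → Set
TightArcOrdering {n} G σ = ArcOrdering G σ ×
  (∀ u v → (∀ w → (N[ u ] G) w → (N[ v ] G) w) → ¬ (∀ w → (N[ v ] G) w) →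
     ∃[ p ] (Endpoint (posSet σ (N[ u ] G)) p × Endpoint (posSet σ (N[ v ] G)) p))

{-# OPTIONS --safe #-}
module Submission where

-- A proper circular-arc model of a twin-free graph, read off by the starting points of
-- its arcs, gives a round ordering: the co-neighbourhood of the i-th vertex is the cyclic
-- interval [x i, y i), with x and y monotone in i.  Regard it as a chord joining two gaps
-- between consecutive vertices.  In any arc ordering τ of the closed neighbourhoods the sets
-- that remain arcs are closed under intersecting crossing arcs and under complements, so it
-- suffices to produce every pair of consecutive vertices from the chords.
--
-- If the complement is not bipartite then x (x a) < a + n for all a (otherwise [a, x a) and
-- its complement would be two cliques), and a monotonicity argument shows that every arc
-- with at least two vertices inside and outside is crossed by a chord.  Repeatedly cutting
-- along crossing chords isolates each consecutive pair.
--
-- If the complement is bipartite and connected, its two sides are cliques occupying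
-- complementary intervals of the round ordering.  In a tight ordering the difference of two
-- nested co-neighbourhoods is an arc as well, and with these additional arcs the same
-- cutting works inside each side.  The two sides are then paths in τ, and they can be
-- joined to a circle in exactly two ways up to reversal.

open import Defs hiding (sym)
open import Data.Bool.Base using (Bool; true; false; not; _xor_)
open import Data.Bool.Properties using () renaming (_≟_ to _≟ᵇ_)
open import Data.Empty using (⊥)
open import Data.Fin.Base using (Fin; toℕ; fromℕ<; punchIn; punchOut)
open import Data.Fin.Properties using (toℕ<n; toℕ-injective; toℕ-fromℕ<; punchIn-injective; punchInᵢ≢i; punchIn-punchOut) renaming (_≟_ to _≟ᶠ_)
open import Data.Nat.Base
open import Data.Nat.Divisibility using (∣-refl)
open import Data.Nat.DivMod using (_mod_; m<n⇒m%n≡m; n%n≡0; [m+n]%n≡m%n; m≡m%n+[m/n]*n; /-monoˡ-≤; +-distrib-/-∣ʳ; n/n≡1)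
open import Data.Nat.Properties
open import Data.Product using (∃-syntax; _×_; _,_; proj₁; proj₂)
open import Data.Sum using (_⊎_; inj₁; inj₂; [_,_]′; swap; map)
open import Function.Base using (_∘_)
open import Function.Bundles using (_⇔_; Inverse; Equivalence; mk⇔; mk↔ₛ′)
open import Relation.Binary.Definitions using (tri<; tri≈; tri>)
open import Relation.Binary.PropositionalEquality
open import Relation.Nullary using (¬_; Dec; yes; no; contradiction)

-- Twin-freeness enters through a duality: a vertex that distinguishes `g` from `suc g` has a
-- co-neighbourhood ending exactly in the gap between them, so every gap is an end of some chord. A
-- chord ending inside an arc may still fail to cross it, and the crossing arguments consist in
-- excluding the few positions of its other end that avoid a crossing. Two obstacles are special to
-- the bipartite case. Every co-neighbourhood lies in one side, so reversing one side alone keeps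
-- all of them intervals; this is the origin of the second ordering. And co-neighbourhoods in one
-- side may be nested with a common end, where there is no crossing to exploit. Positions live on
-- the universal cover with period `n`, which turns arcs into intervals and lets monotonicity be
-- that of the natural numbers. An arc of τ need not look like an interval in the coordinates of τ,
-- so being an arc is expressed by chords of τ that do not cross, a condition symmetric under
-- complement.

-- Round orderings as monotone functions on the universal cover

-- The co-neighbourhood of the vertex at position i of a round ordering occupies
-- the positions x i, …, y i - 1, read modulo n; gal₁ and gal₂ express the symmetry of
-- non-adjacency.
record Dial (n : ℕ) : Set where
  field
    x y : ℕ → ℕ
    x-mono : ∀ {i j} → i ≤ j → x i ≤ x j
    x-per : ∀ i → x (i + n) ≡ x i + n
    i<x : ∀ i → i < x i
    x≤y : ∀ i → x i ≤ y i
    gal₁ : ∀ {u k} → y u ≤ k → u + n < x k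
    gal₂ : ∀ {u k} → u + n < x k → y u ≤ k

  gal₃ : ∀ {u k} → k < y u → x k ≤ u + n
  gal₃ k<y = ≮⇒≥ (λ h → <⇒≱ k<y (gal₂ h))

  gal₄ : ∀ {u k} → x k ≤ u + n → k < y u
  gal₄ x≤ = ≰⇒> (λ h → <⇒≱ (gal₁ h) x≤)

  y≤ : ∀ i → y i ≤ i + n
  y≤ i = gal₂ (i<x (i + n))

  x≤ : ∀ i → x i ≤ i + n
  x≤ i = ≤-trans (x≤y i) (y≤ i)

  i<y : ∀ i → i < y i
  i<y i = <-≤-trans (i<x i) (x≤y i)

  y-mono : ∀ {i j} → i ≤ j → y i ≤ y j
  y-mono {i} {j} i≤j = gal₂ (≤-<-trans (+-monoˡ-≤ n i≤j) (gal₁ ≤-refl))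

  x-per-≤ : ∀ {i j} → x i ≤ j → x (i + n) ≤ j + n
  x-per-≤ {i} x≤j rewrite x-per i = +-monoˡ-≤ n x≤j

  x-per-≥ : ∀ {i j} → j ≤ x i → j + n ≤ x (i + n)
  x-per-≥ {i} j≤x rewrite x-per i = +-monoˡ-≤ n j≤x

  -- `gal₁` and `gal₂` make `y u` the least `k` with `u + n < x k`, so `y` inherits the period of
  -- `x`.
  y-per : ∀ i → y (i + n) ≡ y i + n
  y-per i = ≤-antisym (gal₂ (x-per-≥ (gal₁ {i} ≤-refl))) lower
    where
    k = y (i + n)
    n≤k : n ≤ k
    n≤k = ≤-trans (m≤n+m n i) (<⇒≤ (i<y (i + n)))
    k≡ : k ∸ n + n ≡ k
    k≡ = m∸n+n≡m n≤k
    below : (i + n) + n < x (k ∸ n) + n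
    below = subst (i + n + n <_) (trans (cong x (sym k≡)) (x-per (k ∸ n))) (gal₁ {i + n} ≤-refl)
    lower : y i + n ≤ k
    lower = subst (y i + n ≤_) k≡ (+-monoˡ-≤ n (gal₂ (+-cancelʳ-< n (i + n) (x (k ∸ n)) below)))

  x-reflect : ∀ {i j} → x i < x j → i < j
  x-reflect h = ≰⇒> (λ j≤i → <⇒≱ h (x-mono j≤i))

  y-reflect : ∀ {i j} → y i < y j → i < j
  y-reflect h = ≰⇒> (λ j≤i → <⇒≱ h (y-mono j≤i))

  -- Twin-freeness for consecutive positions: equal `x` and equal `y` would mean equal
  -- co-neighbourhoods.
  Separating : Set
  Separating = ∀ a → x a < x (suc a) ⊎ y a < y (suc a)

  -- Duality of vertices and gaps. If `y` grows at `g`, the vertex `y g` reaches forward to `g` but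
  -- not to `suc g`; if `x` grows, `x g` is reached by `suc g` but not by `g`. The chord of that
  -- vertex ends between the two.
  cut : Separating → ∀ g → (∃[ u ] x u ≡ suc g + n) ⊎ (∃[ u ] y u ≡ suc g + n)
  cut sep g with sep g
  ... | inj₂ h = inj₁ (y g , ≤-antisym (gal₃ h) (gal₁ ≤-refl))
  ... | inj₁ h = inj₂ (x g , ≤-antisym (gal₂ (≤-trans (+-monoˡ-≤ n h) (x-per-≥ ≤-refl)))
                                        (gal₄ (x-per-≤ ≤-refl)))

-- Arcs closed under complement and crossing intersection

-- Good p q is to be read as a property of the arc of positions p, …, q - 1.
record ChordFamily (n : ℕ) (Good : ℕ → ℕ → Set) : Set where
  field
    compl : ∀ {p q} → p < q → q < p + n → Good p q → Good q (p + n)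
    lower : ∀ {p q} → Good (p + n) (q + n) → Good p q
    cap : ∀ {p q p′ q′} → p < p′ → p′ < q → q < q′ → q′ < p + n →
          Good p q → Good p′ q′ → Good p′ q

Crossed : (n : ℕ) → (ℕ → ℕ → Set) → ℕ → ℕ → Set
Crossed n Good p q = ∃[ c ] ∃[ d ] (p < c × c < q × q < d × d < p + n × Good c d)

module Chords {n : ℕ} {Good : ℕ → ℕ → Set} (F : ChordFamily n Good) where
  open ChordFamily F

  -- Complementing twice moves an arc by one full turn.
  raise : ∀ {p q} → p < q → q < p + n → Good p q → Good (p + n) (q + n)
  raise p<q q<p g = compl q<p (+-monoˡ-< n p<q) (compl p<q q<p g)

  module _ {p q p′ q′} (p<p′ : p < p′) (p′<q : p′ < q) (q<q′ : q < q′) (q′<p : q′ < p + n)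
           (g : Good p q) (g′ : Good p′ q′) where
    private
      q<p+n : q < p + n
      q<p+n = <-trans q<q′ q′<p
      g′ᶜ : Good q′ (p′ + n)
      g′ᶜ = compl (<-trans p′<q q<q′) (<-trans q′<p (+-monoˡ-< n p<p′)) g′

    -- The difference of the two arcs, as the intersection of the first with the complement of the
    -- second, computed one turn higher.
    diffˡ : Good p p′
    diffˡ = lower (cap q′<p (+-monoˡ-< n p<p′) (+-monoˡ-< n p′<q) (+-monoˡ-< n q<q′) g′ᶜ
                       (raise (<-trans p<p′ p′<q) q<p+n g))

  crossed-lower : ∀ {p q} → Crossed n Good (p + n) (q + n) → Crossed n Good p q
  crossed-lower {p} {q} (c , d , p<c , c<q , q<d , d<p , g) =
    c ∸ n , d ∸ n
    , +-cancelʳ-< n _ _ (subst (p + n <_) (sym c≡) p<c)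
    , +-cancelʳ-< n _ _ (subst (_< q + n) (sym c≡) c<q)
    , +-cancelʳ-< n _ _ (subst (q + n <_) (sym d≡) q<d)
    , +-cancelʳ-< n _ _ (subst (_< p + n + n) (sym d≡) d<p)
    , lower (subst₂ Good (sym c≡) (sym d≡) g)
    where
    c≡ : c ∸ n + n ≡ c
    c≡ = m∸n+n≡m (≤-trans (m≤n+m n p) (<⇒≤ p<c))
    d≡ : d ∸ n + n ≡ d
    d≡ = m∸n+n≡m (≤-trans (m≤n+m n q) (<⇒≤ q<d))

  crossed-swap : ∀ {p q} → Crossed n Good q (p + n) → Crossed n Good p q
  crossed-swap {p} {q} (c , d , q<c , c<p , p<d , d<q , g) =
    crossed-lower (d , c + n , p<d , d<q , +-monoˡ-< n q<c , +-monoˡ-< n c<p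
                  , compl (<-trans c<p p<d) (<-trans d<q (+-monoˡ-< n q<c)) g)

-- Crossing chords when the complement is not bipartite

module NonBipartite {n : ℕ} (D : Dial n) {Good : ℕ → ℕ → Set} (F : ChordFamily n Good)
    (good-E : ∀ w → Good (Dial.x D w) (Dial.y D w)) where
  open Dial D
  open ChordFamily F
  open Chords F

  -- A chord with one end strictly inside can avoid crossing only by having its other end in one of
  -- two places. Each use below excludes at least one of them.
  cross-x : ∀ {p q} w → p < x w → x w < q → Crossed n Good p q ⊎ (y w ≤ q ⊎ p + n ≤ y w)
  cross-x {p} {q} w p<x x<q with y w ≤? q | p + n ≤? y w
  ... | yes h | _ = inj₂ (inj₁ h)
  ... | no _ | yes h = inj₂ (inj₂ h)
  ... | no h | no h′ = inj₁ (x w , y w , p<x , x<q , ≰⇒> h , ≰⇒> h′ , good-E w)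

  cross-y : ∀ {p q} w → p < q → p < y w → y w < q → Crossed n Good p q ⊎ (x w + n ≤ q ⊎ p ≤ x w)
  cross-y {p} {q} w p<q p<y y<q with x w + n ≤? q | p ≤? x w
  ... | yes h | _ = inj₂ (inj₁ h)
  ... | no _ | yes h = inj₂ (inj₂ h)
  ... | no h | no h′ = inj₁ (y w , x w + n , p<y , y<q , ≰⇒> h , +-monoˡ-< n (≰⇒> h′)
                            , compl (<-trans (≰⇒> h′) p<y) (<-trans y<q (≰⇒> h)) (good-E w))

  module _ (nb : ∀ a → x (x a) < a + n) (sep : Separating) where

    reach-y : ∀ a → a + n < y (x a)
    reach-y a = gal₄ (x-per-≤ ≤-refl)

    -- The arc [P, Q) = [suc p₀, 2 + r) has at least two vertices inside and outside, and P is
    -- adjacent to its predecessor.  The common co-neighbour b = x P of p₀ and P lies in [P, Q)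
    -- (case A) or outside it (case B).  If no chord crosses [P, Q), a vertex distinguishing two
    -- consecutive vertices outside (A) or inside (B) of [P, Q) has nowhere to lie.
    module At (p₀ r : ℕ) (adj : suc p₀ < x p₀) (2≤I : suc p₀ ≤ r) (SQ<P+n : suc (suc (suc r)) < suc p₀ + n) where
      P = suc p₀
      q₀ = suc r
      Q = suc q₀
      b = x P
      X = Crossed n Good P Q

      P<Q : P < Q
      P<Q = m≤n⇒m≤1+n (s≤s 2≤I)

      Q<P+n : Q < P + n
      Q<P+n = <-trans (n<1+n Q) SQ<P+n

      adj-n : P + n < x (p₀ + n)
      adj-n = x-per-≥ adj

      swap-lower : Crossed n Good (Q + n) (P + n + n) → X
      swap-lower c = crossed-swap (crossed-lower c)

      module CaseA (b<Q : b < Q) where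

        -- The chord of `x Q` extends so far that `x` agrees at `Q` and `suc Q`, so these differ in
        -- `y`. Then the chord of `y Q` starts in the gap between them, and both ways of not
        -- crossing fail.
        stage₄ : P + n < x Q → x b ≤ Q → x (x Q) < Q + n → P + n + n ≤ y (x Q) → X
        stage₄ P<c xb≤Q xc< yc≥ with sep Q
        ... | inj₁ h = contradiction h (≤⇒≯ (+-cancelʳ-≤ n _ _
          (subst (_≤ x Q + n) (x-per (suc Q)) (gal₃ (<-≤-trans (+-monoˡ-< n SQ<P+n) yc≥)))))
        ... | inj₂ h = go (cross-x l Q<xl xl<)
          where
          l = y Q
          Q<xl : Q + n < x l
          Q<xl = gal₁ ≤-refl
          xl≤ : x l ≤ suc Q + n
          xl≤ = gal₃ h
          xl< : x l < P + n + n
          xl< = ≤-<-trans xl≤ (+-monoˡ-< n SQ<P+n)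
          l< : l < Q + n
          l< = ≰⇒> λ k → <⇒≱ (<-trans SQ<P+n P<c)
                 (+-cancelʳ-≤ n _ _ (≤-trans (subst (_≤ x l) (x-per Q) (x-mono k)) xl≤))
          b<l : b + n < l
          b<l = x-reflect (≤-<-trans (subst (_≤ Q + n) (sym (x-per b)) (+-monoˡ-≤ n xb≤Q)) Q<xl)
          go : Crossed n Good (Q + n) (P + n + n) ⊎ (y l ≤ P + n + n ⊎ Q + n + n ≤ y l) → X
          go (inj₁ c) = swap-lower c
          go (inj₂ (inj₁ k)) = contradiction (≤-trans (≤-trans (≤-reflexive (sym (y-per b))) (y-mono (<⇒≤ b<l))) k)
                                 (<⇒≱ (+-monoˡ-< n (reach-y P)))
          go (inj₂ (inj₂ k)) = contradiction (≤-trans k (y≤ l)) (<⇒≱ (+-monoˡ-< n l<))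

        stage₃ : x b ≤ Q → y P ≤ Q → X
        stage₃ xb≤Q yP≤Q = go (cross-x {P + n} {Q + n} c (<-trans P<c (i<x c)) (nb Q))
          where
          c = x Q
          P<c : P + n < c
          P<c = gal₁ yP≤Q
          go : Crossed n Good (P + n) (Q + n) ⊎ (y c ≤ Q + n ⊎ P + n + n ≤ y c) → X
          go (inj₁ k) = crossed-lower k
          go (inj₂ (inj₁ k)) = contradiction k (<⇒≱ (reach-y Q))
          go (inj₂ (inj₂ k)) = stage₄ P<c xb≤Q (nb Q) k

        stage₂ : x b ≤ Q → X
        stage₂ xb≤Q = go (cross-x {P} {Q} P (i<x P) b<Q)
          where
          go : X ⊎ (y P ≤ Q ⊎ P + n ≤ y P) → X
          go (inj₁ k) = k
          go (inj₂ (inj₁ k)) = stage₃ xb≤Q k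
          go (inj₂ (inj₂ k)) = contradiction (≤-trans k (gal₂ adj-n)) (<⇒≱ (n<1+n _))

        result : X
        result = go (cross-y {P + n} {Q + n} b (+-monoˡ-< n P<Q) (reach-y P) (≤-<-trans (y≤ b) (+-monoˡ-< n b<Q)))
          where
          go : Crossed n Good (P + n) (Q + n) ⊎ (x b + n ≤ Q + n ⊎ P + n ≤ x b) → X
          go (inj₁ k) = crossed-lower k
          go (inj₂ (inj₁ k)) = stage₂ (+-cancelʳ-≤ n _ _ k)
          go (inj₂ (inj₂ k)) = contradiction k (<⇒≱ (nb P))

      module CaseB (Q≤b : Q ≤ b) where

        -- The last two vertices `r` and `q₀` of `[P, Q)` would be twins: the chord of `d₀` excludes
        -- a difference in `y`, that of `b` a difference in `x`.
        stage₃ : ∀ d₀ → y q₀ ≡ suc d₀ → Q + n ≤ y b → x d₀ ≤ P + n → X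
        stage₃ d₀ y≡ yb≥ xd₀≤ with sep r
        ... | inj₂ h = contradiction (+-cancelʳ-< n _ _ (<-≤-trans (gal₁ (s≤s⁻¹ (subst (y r <_) y≡ h))) xd₀≤)) (≤⇒≯ 2≤I)
        ... | inj₁ h = contradiction (≤-trans yb≥ (≤-trans (y-mono b≤l) yl≤)) (<⇒≱ (n<1+n _))
          where
          l = pred (x q₀)
          l≡ : suc l ≡ x q₀
          l≡ = suc-pred (x q₀) ⦃ >-nonZero (≤-<-trans z≤n (i<x q₀)) ⦄
          b≤l : b ≤ l
          b≤l = ≤-trans (x-mono 2≤I) (s≤s⁻¹ (subst (x r <_) (sym l≡) h))
          yl≤ : y l ≤ q₀ + n
          yl≤ = gal₂ (x-per-≥ (≤-reflexive l≡))

        stage₂ : Q + n ≤ y b → Q ≤ x p₀ → X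
        stage₂ yb≥ Q≤xp = go (cross-y {Q + n} {P + n + n} d₀ (+-monoˡ-< n Q<P+n) Q<yd yd<)
          where
          -- The last co-neighbour of `q₀`.
          d₀ = pred (y q₀)
          d≡ : suc d₀ ≡ y q₀
          d≡ = suc-pred (y q₀) ⦃ >-nonZero (≤-<-trans z≤n (i<y q₀)) ⦄
          d≤ : y q₀ ≤ p₀ + n
          d≤ = gal₂ (x-per-≥ Q≤xp)
          xQ≤d₀ : x Q ≤ d₀
          xQ≤d₀ = s≤s⁻¹ (subst (x Q <_) (sym d≡) (gal₄ (s≤s⁻¹ (nb Q))))
          Q<yd : Q + n < y d₀
          Q<yd = gal₄ (x-per-≤ xQ≤d₀)
          yd< : y d₀ < P + n + n
          yd< = ≤-<-trans (y≤ d₀) (+-monoˡ-< n (≤-trans (≤-reflexive d≡) (≤-trans d≤ (n≤1+n _))))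
          xd₀≤ : x d₀ ≤ q₀ + n
          xd₀≤ = gal₃ (≤-reflexive d≡)
          go : Crossed n Good (Q + n) (P + n + n) ⊎ (x d₀ + n ≤ P + n + n ⊎ Q + n ≤ x d₀) → X
          go (inj₁ k) = swap-lower k
          go (inj₂ (inj₁ k)) = stage₃ d₀ (sym d≡) yb≥ (+-cancelʳ-≤ n _ _ k)
          go (inj₂ (inj₂ k)) = contradiction (≤-trans k xd₀≤) (<⇒≱ (n<1+n _))

        stage₁ : Q + n ≤ y b → X
        stage₁ yb≥ = go (cross-y {Q} {P + n} p₀ Q<P+n (≤-<-trans Q≤b b<yp) (s≤s (y≤ p₀)))
          where
          b<yp : b < y p₀
          b<yp = gal₄ (s≤s⁻¹ (nb P))
          go : Crossed n Good Q (P + n) ⊎ (x p₀ + n ≤ P + n ⊎ Q ≤ x p₀) → X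
          go (inj₁ k) = crossed-swap k
          go (inj₂ (inj₁ k)) = contradiction (+-cancelʳ-≤ n _ _ k) (<⇒≱ adj)
          go (inj₂ (inj₂ k)) = stage₂ yb≥ k

        result : X
        result = go (cross-x {Q} {P + n} b (≤-<-trans Q≤b (i<x b)) (nb P))
          where
          go : Crossed n Good Q (P + n) ⊎ (y b ≤ P + n ⊎ Q + n ≤ y b) → X
          go (inj₁ k) = crossed-swap k
          go (inj₂ (inj₁ k)) = contradiction k (<⇒≱ (reach-y P))
          go (inj₂ (inj₂ k)) = stage₁ k

      crossed : X
      crossed with b <? Q
      ... | yes h = CaseA.result h
      ... | no h = CaseB.result (≮⇒≥ h)

-- Isolating consecutive pairs by repeated cutting

-- If the chord crossing [p, q) ends exactly at the gap between a and suc a, both halves of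
-- [p, q) are good, and a chord crossing the larger half cuts [p, q) elsewhere.
module Trim {n : ℕ} {Good : ℕ → ℕ → Set} (F : ChordFamily n Good)
    (Small : ℕ → ℕ → Set)
    (shrink : ∀ {p q p′ q′} → p ≤ p′ → q′ ≤ q → Small p q → Small p′ q′)
    (crossed : ∀ {p q} → Small p q → suc p < q → Crossed n Good p q) where
  open ChordFamily F
  open Chords F

  trim : ∀ m {p q} a → q ≤ m + p → Small p q → p ≤ a → suc a < q → Good p q → Good a (2 + a)
  trim zero a fuel small p≤a a<q g = contradiction (≤-trans (<⇒≤ a<q) (≤-trans fuel p≤a)) (<⇒≱ (n<1+n a))
  trim (suc m) {p} {q} a fuel small p≤a a<q g with q ≤? 2 + p
  ... | yes q≤ = subst₂ Good p≡a q≡ g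
    where
    p≡a : p ≡ a
    p≡a = ≤-antisym p≤a (s≤s⁻¹ (s≤s⁻¹ (≤-trans a<q q≤)))
    q≡ : q ≡ 2 + a
    q≡ = ≤-antisym (≤-trans q≤ (+-monoʳ-≤ 2 p≤a)) a<q
  ... | no q≰ with crossed small (≤-trans (s≤s (s≤s p≤a)) a<q)
  ... | c , d , p<c , c<q , q<d , d<p , h with <-cmp c (suc a)
  ... | tri< c<a _ _ = trim m a fuel′ (shrink (<⇒≤ p<c) ≤-refl small) (s≤s⁻¹ c<a) a<q (cap p<c c<q q<d d<p g h)
    where
    fuel′ : q ≤ m + c
    fuel′ = ≤-trans fuel (≤-trans (≤-reflexive (sym (+-suc m p))) (+-monoʳ-≤ m p<c))
  ... | tri> _ _ a<c = trim m a (s≤s⁻¹ (≤-trans c<q fuel)) (shrink ≤-refl (<⇒≤ c<q) small) p≤a a<c (diffˡ p<c c<q q<d d<p g h)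
  ... | tri≈ _ refl _ with 2 + p ≤? suc a
  -- The left half `[p, suc a)` has two vertices, so a chord starts inside it and passes over the
  -- gap after `a`.
  ... | yes 2≤ with crossed (shrink ≤-refl (<⇒≤ c<q) small) 2≤
  ...   | c′ , d′ , p<c′ , c′<a , a<d′ , d′<p , h′ with d′ ≤? q
  ...   | yes d′≤q = trim m a (≤-trans d′≤q fuel′) (shrink (<⇒≤ p<c′) d′≤q small) (s≤s⁻¹ c′<a) a<d′ h′
    where
    fuel′ : q ≤ m + c′
    fuel′ = ≤-trans fuel (≤-trans (≤-reflexive (sym (+-suc m p))) (+-monoʳ-≤ m p<c′))
  ...   | no d′≰q = trim m a fuel′ (shrink (<⇒≤ p<c′) ≤-refl small) (s≤s⁻¹ c′<a) a<q
                         (cap p<c′ (<-trans c′<a a<q) (≰⇒> d′≰q) d′<p g h′)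
    where
    fuel′ : q ≤ m + c′
    fuel′ = ≤-trans fuel (≤-trans (≤-reflexive (sym (+-suc m p))) (+-monoʳ-≤ m p<c′))
  trim (suc m) {p} {q} a fuel small p≤a a<q g | no q≰ | c , d , p<c , c<q , q<d , d<p , h | tri≈ _ refl _ | no 2≰
    with crossed (shrink (<⇒≤ p<c) ≤-refl small) (≤-<-trans (s≤s (s≤s (≮⇒≥ λ k → 2≰ (s≤s k)))) (≰⇒> q≰))
  ...   | c′ , d′ , a<c′ , c′<q , q<d′ , d′<a , h′ with d′ <? p + n
  ...   | yes d′<p = trim m a (s≤s⁻¹ (≤-trans c′<q fuel)) (shrink ≤-refl (<⇒≤ c′<q) small) p≤a a<c′
                          (diffˡ (<-trans p<c a<c′) c′<q q<d′ d′<p g h′)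
  -- The chord runs past `p + n`. Its complement, one turn lower, is `[d′ - n, c′)`, which lies in
  -- `[p, q)` and contains `a` and `suc a`.
  ...   | no d′≮p = trim m a (≤-trans (s≤s⁻¹ (≤-trans c′<q fuel)) (+-monoʳ-≤ m p≤e)) (shrink p≤e (<⇒≤ c′<q) small) e≤a a<c′
                         (lower (subst (λ z → Good z (c′ + n)) (sym e≡) (compl (<-trans c′<q q<d′) (<-trans d′<a (+-monoˡ-< n a<c′)) h′)))
    where
    e = d′ ∸ n
    e≡ : e + n ≡ d′
    e≡ = m∸n+n≡m (≤-trans (m≤n+m n p) (≮⇒≥ d′≮p))
    p≤e : p ≤ e
    p≤e = +-cancelʳ-≤ n p e (≤-trans (≮⇒≥ d′≮p) (≤-reflexive (sym e≡)))
    e≤a : e ≤ a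
    e≤a = s≤s⁻¹ (+-cancelʳ-< n e (suc a) (≤-<-trans (≤-reflexive e≡) d′<a))

module AllPairs {n : ℕ} (D : Dial n) {Good : ℕ → ℕ → Set} (F : ChordFamily n Good)
    (good-E : ∀ w → Good (Dial.x D w) (Dial.y D w))
    (nb : ∀ a → Dial.x D (Dial.x D a) < a + n) (sep : Dial.Separating D)
    (linked : ∀ p q → p < q → q < p + n → suc p < Dial.x D p ⊎ suc q < Dial.x D q) where
  open Dial D
  open ChordFamily F
  open Chords F

  crossed-linked : ∀ p q → suc p < x p → 2 + p ≤ q → 2 + q ≤ p + n → Crossed n Good (suc p) (suc q)
  crossed-linked p (suc r) adj 2≤ ≤n = NonBipartite.At.crossed D F good-E nb sep p r adj (s≤s⁻¹ 2≤) (s≤s ≤n)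

  -- The crossing argument needs an adjacency across the gap where the arc starts. If it is missing
  -- there, connectedness provides one at the other end, which is the start of the complement.
  crossed-suc : ∀ p q → 2 + p ≤ q → 2 + q ≤ p + n → Crossed n Good (suc p) (suc q)
  crossed-suc p q 2≤ ≤n with linked p q (<-trans (n<1+n p) 2≤) (<-trans (n<1+n q) ≤n)
  ... | inj₁ adj = crossed-linked p q adj 2≤ ≤n
  ... | inj₂ adj = crossed-swap (crossed-linked q (p + n) adj ≤n (+-monoˡ-≤ n 2≤))

  0<n : 0 < n
  0<n = ≤-<-trans z≤n (nb 0)

  Small : ℕ → ℕ → Set
  Small p q = 2 + q ≤ p + n

  crossed : ∀ {p q} → Small p q → suc p < q → Crossed n Good p q
  -- Going up one turn provides the predecessors that `crossed-suc` asks for, even at position 0.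
  crossed {p} {q} ≤n 2≤ = crossed-lower (subst₂ (Crossed n Good) (pred≡ p) (pred≡ q)
      (crossed-suc (pred (p + n)) (pred (q + n))
        (s≤s⁻¹ (subst₂ (λ a b → 2 + a ≤ b) (sym (pred≡ p)) (sym (pred≡ q)) (+-monoˡ-≤ n 2≤)))
        (s≤s⁻¹ (subst₂ (λ a b → 2 + a ≤ b + n) (sym (pred≡ q)) (sym (pred≡ p)) (+-monoˡ-≤ n ≤n)))))
    where
    pred≡ : ∀ i → suc (pred (i + n)) ≡ i + n
    pred≡ i = suc-pred (i + n) ⦃ >-nonZero (≤-trans 0<n (m≤n+m n i)) ⦄

  shrink : ∀ {p q p′ q′} → p ≤ p′ → q′ ≤ q → Small p q → Small p′ q′
  shrink p≤ q≤ s = ≤-trans (s≤s (s≤s q≤)) (≤-trans s (+-monoˡ-≤ n p≤))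

  4≤n : 4 ≤ n
  4≤n with linked 0 1 (n<1+n 0) (≤-<-trans (i<x 0) (<-trans (i<x (x 0)) (nb 0)))
  ... | inj₁ h = ≤-trans (s≤s (≤-<-trans h (i<x (x 0)))) (nb 0)
  ... | inj₂ h = s≤s⁻¹ (≤-trans (s≤s (≤-<-trans h (i<x (x 1)))) (nb 1))

  -- Trimming must start from a good arc around `a` and `suc a`. The first chord only separates the
  -- two, giving a good arc that starts at `suc a`; a chord crossing that arc has a complement which
  -- contains both.
  pair : ∀ a → Good a (2 + a)
  pair a with crossed {a} {2 + a} (subst (4 + a ≤_) (+-comm n a) (+-monoˡ-≤ a 4≤n)) ≤-refl
  ... | c , d , a<c , c<a , a<d , d<a , h with ≤-antisym a<c (s≤s⁻¹ c<a)
  ... | refl with crossed {suc a} {d} (s≤s d<a) a<d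
  ... | c′ , d′ , a<c′ , c′<d , d<d′ , d′<a , h′ =
    lower (Trim.trim F Small shrink crossed (c′ + n) (a + n) (m≤m+n (c′ + n) d′) (+-monoˡ-≤ n (<-≤-trans (s≤s c′<d) d<d′)) (s≤s⁻¹ d′<a)
                (+-monoˡ-< n a<c′)
                (compl (<-trans c′<d d<d′) (<-trans d′<a (+-monoˡ-< n a<c′)) h′))

-- Betweenness and neighbouring positions on a circle

<ᵇ-true : ∀ {i j} → i < j → (i <ᵇ j) ≡ true
<ᵇ-true {zero} {suc j} h = refl
<ᵇ-true {suc i} {suc j} h = <ᵇ-true (s≤s⁻¹ h)

<ᵇ-false : ∀ {i j} → j ≤ i → (i <ᵇ j) ≡ false
<ᵇ-false {i} {zero} h = refl
<ᵇ-false {suc i} {suc j} h = <ᵇ-false (s≤s⁻¹ h)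

<ᵇ-antisym : ∀ {i j} → i ≢ j → (i <ᵇ j) ≡ not (j <ᵇ i)
<ᵇ-antisym {i} {j} i≢j with <-cmp i j
... | tri< h _ _ = trans (<ᵇ-true h) (cong not (sym (<ᵇ-false (<⇒≤ h))))
... | tri≈ _ h _ = contradiction h i≢j
... | tri> _ _ h = trans (<ᵇ-false (<⇒≤ h)) (cong not (sym (<ᵇ-true h)))

-- For k different from i and j: whether k lies strictly between i and j.
between : ℕ → ℕ → ℕ → Bool
between i j k = (i <ᵇ k) xor (j <ᵇ k)

xor-transpose : ∀ a b c d → a xor b ≡ c xor d → not a xor not c ≡ not b xor not d
xor-transpose false false false false _ = refl
xor-transpose false false true true _ = refl
xor-transpose false true false true _ = refl
xor-transpose false true true false _ = refl
xor-transpose true false false true _ = refl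
xor-transpose true false true false _ = refl
xor-transpose true true false false _ = refl
xor-transpose true true true true _ = refl

-- Crossing of two chords is symmetric in the chords.
between-transpose : ∀ i j k l → k ≢ i → l ≢ i → k ≢ j → l ≢ j →
                    between k l i ≡ between k l j → between i j k ≡ between i j l
between-transpose i j k l k≢i l≢i k≢j l≢j eq = begin
  (i <ᵇ k) xor (j <ᵇ k)             ≡⟨ cong₂ _xor_ (<ᵇ-antisym (k≢i ∘ sym)) (<ᵇ-antisym (k≢j ∘ sym)) ⟩
  not (k <ᵇ i) xor not (k <ᵇ j)     ≡⟨ xor-transpose (k <ᵇ i) (l <ᵇ i) (k <ᵇ j) (l <ᵇ j) eq ⟩
  not (l <ᵇ i) xor not (l <ᵇ j)     ≡⟨ cong₂ _xor_ (<ᵇ-antisym (l≢i ∘ sym)) (<ᵇ-antisym (l≢j ∘ sym)) ⟨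
  (i <ᵇ l) xor (j <ᵇ l)             ∎
  where open ≡-Reasoning

-- Cyclic succession without `mod`, so that the linear comparisons inside `between` apply to it.
Next : ∀ {n} → Fin n → Fin n → Set
Next {n} p q = toℕ q ≡ suc (toℕ p) ⊎ (toℕ q ≡ 0 × suc (toℕ p) ≡ n)

next-sucC : ∀ {n} {p q : Fin n} → Next p q → sucC p ≡ q
next-sucC {suc k} {p} {q} (inj₁ h) = toℕ-injective (trans (toℕ-fromℕ< _) (trans
  (m<n⇒m%n≡m (subst (_< suc k) h (toℕ<n q))) (sym h)))
next-sucC {suc k} {p} {q} (inj₂ (h , h′)) = toℕ-injective (trans (toℕ-fromℕ< _) (trans
  (trans (cong (_% suc k) h′) (n%n≡0 (suc k))) (sym h)))

next-predC : ∀ {n} {p q : Fin n} → Next p q → predC q ≡ p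
next-predC {suc k} {p} {q} (inj₁ h) = toℕ-injective (trans (toℕ-fromℕ< _) (begin
  (toℕ q + k) % suc k       ≡⟨ cong (λ z → (z + k) % suc k) h ⟩
  suc (toℕ p + k) % suc k   ≡⟨ cong (_% suc k) (+-suc (toℕ p) k) ⟨
  (toℕ p + suc k) % suc k   ≡⟨ [m+n]%n≡m%n (toℕ p) (suc k) ⟩
  toℕ p % suc k             ≡⟨ m<n⇒m%n≡m (toℕ<n p) ⟩
  toℕ p                     ∎))
  where open ≡-Reasoning
next-predC {suc k} {p} {q} (inj₂ (h , h′)) = toℕ-injective (trans (toℕ-fromℕ< _) (begin
  (toℕ q + k) % suc k       ≡⟨ cong (λ z → (z + k) % suc k) h ⟩
  k % suc k                 ≡⟨ m<n⇒m%n≡m (n<1+n k) ⟩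
  k                         ≡⟨ suc-injective h′ ⟨
  toℕ p                     ∎))
  where open ≡-Reasoning

next-of-sucC : ∀ {n} (p : Fin n) → Next p (sucC p)
next-of-sucC {suc k} p with suc (toℕ p) <? suc k
... | yes h = inj₁ (trans (toℕ-fromℕ< _) (m<n⇒m%n≡m h))
... | no h = inj₂ (trans (toℕ-fromℕ< _) (trans (cong (_% suc k) p≡) (n%n≡0 (suc k))) , p≡)
  where
  p≡ : suc (toℕ p) ≡ suc k
  p≡ = ≤-antisym (toℕ<n p) (≮⇒≥ h)

next-of-predC : ∀ {n} (p : Fin n) → Next (predC p) p
next-of-predC {suc k} p = go (toℕ p) refl
  where
  go : ∀ i → toℕ p ≡ i → Next (predC p) p
  go zero eq = inj₂ (eq , cong suc (trans (toℕ-fromℕ< _)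
    (trans (cong (λ z → (z + k) % suc k) eq) (m<n⇒m%n≡m (n<1+n k)))))
  go (suc i) eq = inj₁ (trans eq (cong suc (sym (trans (toℕ-fromℕ< _) (begin
    (toℕ p + k) % suc k   ≡⟨ cong (λ z → (z + k) % suc k) eq ⟩
    suc (i + k) % suc k   ≡⟨ cong (_% suc k) (+-suc i k) ⟨
    (i + suc k) % suc k   ≡⟨ [m+n]%n≡m%n i (suc k) ⟩
    i % suc k             ≡⟨ m<n⇒m%n≡m (≤-trans (n≤1+n _) (≤-trans (≤-reflexive (cong suc (sym eq))) (toℕ<n p))) ⟩
    i                     ∎)))))
    where open ≡-Reasoning

Alike : ∀ {n} → Fin n → Fin n → Set
Alike {n} p q = ∀ (c d : Fin n) → c ≢ p → c ≢ q → d ≢ p → d ≢ q →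
  between (toℕ p) (toℕ q) (toℕ c) ≡ between (toℕ p) (toℕ q) (toℕ d)

-- If `suc p` lies strictly between `p` and `q`, no position may lie outside them. Testing 0 and the
-- position after `q` leaves only the wrap-around pair.
neighbours-< : ∀ {n} {p q : Fin n} → toℕ p < toℕ q → Alike p q → Next p q ⊎ Next q p
neighbours-< {n} {p} {q} p<q alike with suc (toℕ p) ≟ toℕ q
... | yes h = inj₁ (inj₁ (sym h))
... | no h = outer (toℕ p) refl
  where
  module Position {i : ℕ} (i<n : i < n) where
    at : Fin n
    at = fromℕ< i<n
    at≡ : toℕ at ≡ i
    at≡ = toℕ-fromℕ< i<n
    avoids : ∀ {r : Fin n} → i ≢ toℕ r → at ≢ r
    avoids i≢r eq = i≢r (trans (sym at≡) (cong toℕ eq))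
  sp<q : suc (toℕ p) < toℕ q
  sp<q = ≤∧≢⇒< p<q h
  module Mid = Position (<-trans sp<q (toℕ<n q))
  no-outside : ∀ {i} (i<n : i < n) → i ≢ toℕ p → i ≢ toℕ q → between (toℕ p) (toℕ q) i ≡ false → ⊥
  no-outside i<n i≢p i≢q b = contradiction (trans (sym inner) (trans
      (alike Mid.at (Position.at i<n) (Mid.avoids (>⇒≢ (n<1+n _))) (Mid.avoids h)
        (Position.avoids i<n i≢p) (Position.avoids i<n i≢q))
      (trans (cong (between (toℕ p) (toℕ q)) (Position.at≡ i<n)) b))) λ ()
    where
    inner : between (toℕ p) (toℕ q) (toℕ Mid.at) ≡ true
    inner = trans (cong (between (toℕ p) (toℕ q)) Mid.at≡)
                  (cong₂ _xor_ (<ᵇ-true (n<1+n (toℕ p))) (<ᵇ-false (<⇒≤ sp<q)))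
  outer : ∀ i → toℕ p ≡ i → Next p q ⊎ Next q p
  outer (suc i) eq = contradiction (cong₂ _xor_ (<ᵇ-false {toℕ p} z≤n) (<ᵇ-false {toℕ q} z≤n))
    (no-outside (≤-<-trans z≤n (toℕ<n p)) (λ e → 0≢1+n (trans e eq)) (<⇒≢ (≤-<-trans z≤n p<q)))
  outer zero eq with suc (toℕ q) ≟ n
  ... | yes h′ = inj₂ (inj₂ (eq , h′))
  ... | no h′ = contradiction (cong₂ _xor_ (<ᵇ-true (<-trans p<q (n<1+n _))) (<ᵇ-true (n<1+n (toℕ q))))
    (no-outside (≤∧≢⇒< (toℕ<n q) h′) (>⇒≢ (<-trans p<q (n<1+n _))) (>⇒≢ (n<1+n _)))

xor-swap : ∀ a b → a xor b ≡ b xor a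
xor-swap false false = refl
xor-swap false true = refl
xor-swap true false = refl
xor-swap true true = refl

neighbours : ∀ {n} {p q : Fin n} → p ≢ q → Alike p q → Next p q ⊎ Next q p
neighbours {n} {p} {q} p≢q alike with <-cmp (toℕ p) (toℕ q)
... | tri≈ _ h _ = contradiction (toℕ-injective h) p≢q
... | tri< p<q _ _ = neighbours-< p<q alike
... | tri> _ _ q<p = swap (neighbours-< q<p alike′)
  where
  flip : ∀ c → between (toℕ q) (toℕ p) c ≡ between (toℕ p) (toℕ q) c
  flip c = xor-swap (toℕ q <ᵇ c) (toℕ p <ᵇ c)
  alike′ : Alike q p
  alike′ c d c≢q c≢p d≢q d≢p = trans (flip (toℕ c)) (trans (alike c d c≢p c≢q d≢p d≢q) (sym (flip (toℕ d))))

-- Across a pair of neighbouring positions the comparison with i changes only at the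
-- wrap-around, and then it changes for every i.
between-next : ∀ {n} {p q a b : Fin n} → Next p q → a ≢ p → a ≢ q → b ≢ p → b ≢ q →
               between (toℕ a) (toℕ b) (toℕ p) ≡ between (toℕ a) (toℕ b) (toℕ q)
between-next {n} {p} {q} {a} {b} (inj₁ h) a≢p a≢q b≢p b≢q = cong₂ _xor_ (same a≢p) (same b≢p)
  where
  same : ∀ {a : Fin n} → a ≢ p → (toℕ a <ᵇ toℕ p) ≡ (toℕ a <ᵇ toℕ q)
  same {a} a≢p with <-cmp (toℕ a) (toℕ p)
  ... | tri< k _ _ = trans (<ᵇ-true k) (sym (<ᵇ-true (subst (toℕ a <_) (sym h) (m<n⇒m<1+n k))))
  ... | tri≈ _ k _ = contradiction (toℕ-injective k) a≢p
  ... | tri> _ _ k = trans (<ᵇ-false (<⇒≤ k)) (sym (<ᵇ-false (subst (_≤ toℕ a) (sym h) k)))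
between-next {n} {p} {q} {a} {b} (inj₂ (h , h′)) a≢p a≢q b≢p b≢q =
  trans (cong₂ _xor_ (last a≢p) (last b≢p)) (sym (cong₂ _xor_ (first a) (first b)))
  where
  last : ∀ {a : Fin n} → a ≢ p → (toℕ a <ᵇ toℕ p) ≡ true
  last {a} a≢p = <ᵇ-true (≤∧≢⇒< (s≤s⁻¹ (subst (toℕ a <_) (sym h′) (toℕ<n a))) (a≢p ∘ toℕ-injective))
  first : ∀ (a : Fin n) → (toℕ a <ᵇ toℕ q) ≡ false
  first a = <ᵇ-false {toℕ a} (≤-trans (≤-reflexive h) z≤n)

module _ {n : ℕ} (P : Fin n → Set) where
  -- Two non-members cut the circle into two pieces, and an arc avoiding both stays in one piece.
  separated : IsArc n P → ∀ {a b c d} → ¬ P a → ¬ P b → P c → P d →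
              between (toℕ a) (toℕ b) (toℕ c) ≡ between (toℕ a) (toℕ b) (toℕ d)
  separated (s , e , s≤e , e≤n , inj₁ f) {a} {b} {c} {d} ¬a ¬b pc pd =
    cong₂ _xor_ (outside ¬a) (outside ¬b)
    where
    c∈ = Equivalence.to (f c) pc
    d∈ = Equivalence.to (f d) pd
    outside : ∀ {a} → ¬ P a → (toℕ a <ᵇ toℕ c) ≡ (toℕ a <ᵇ toℕ d)
    outside {a} ¬a with toℕ a <? s
    ... | yes a<s = trans (<ᵇ-true (<-≤-trans a<s (proj₁ c∈))) (sym (<ᵇ-true (<-≤-trans a<s (proj₁ d∈))))
    ... | no a≮s = trans (<ᵇ-false (<⇒≤ (<-≤-trans (proj₂ c∈) e≤a))) (sym (<ᵇ-false (<⇒≤ (<-≤-trans (proj₂ d∈) e≤a))))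
      where
      e≤a : e ≤ toℕ a
      e≤a = ≮⇒≥ (λ a<e → ¬a (Equivalence.from (f a) (≮⇒≥ a≮s , a<e)))
  separated (s , e , s≤e , e≤n , inj₂ f) {a} {b} {c} {d} ¬a ¬b pc pd =
    trans (inside pc) (sym (inside pd))
    where
    in-s : ∀ {a} → ¬ P a → s ≤ toℕ a
    in-s {a} ¬a = ≮⇒≥ λ h → ¬a (Equivalence.from (f a) (λ k → <⇒≱ h (proj₁ k)))
    in-e : ∀ {a} → ¬ P a → toℕ a < e
    in-e {a} ¬a = ≰⇒> λ h → ¬a (Equivalence.from (f a) (λ k → <⇒≱ (proj₂ k) h))
    xor-self : ∀ b → b xor b ≡ false
    xor-self false = refl
    xor-self true = refl
    inside : ∀ {c} → P c → between (toℕ a) (toℕ b) (toℕ c) ≡ false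
    inside {c} pc with toℕ c <? s
    ... | yes c<s = cong₂ _xor_ (<ᵇ-false (≤-trans (<⇒≤ c<s) (in-s ¬a))) (<ᵇ-false (≤-trans (<⇒≤ c<s) (in-s ¬b)))
    ... | no c≮s = cong₂ _xor_ (<ᵇ-true (<-≤-trans (in-e ¬a) e≤c)) (<ᵇ-true (<-≤-trans (in-e ¬b) e≤c))
      where
      e≤c : e ≤ toℕ c
      e≤c = ≮⇒≥ (λ c<e → Equivalence.to (f c) pc (≮⇒≥ c≮s , c<e))

-- An arbitrary arc ordering seen from the round ordering

-- Vertices listed along the circle, indexed by the positions of its universal cover.
record Cycle (n : ℕ) : Set where
  field
    at : ℕ → Fin n
    at-per : ∀ i → at (i + n) ≡ at i
    at-inj : ∀ {i j} → i < j → j < i + n → at i ≢ at j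
    index : Fin n → ℕ
    index< : ∀ u → index u < n
    at-index : ∀ u → at (index u) ≡ u

  index-from : ∀ a u → ∃[ i ] (a ≤ i × i < a + n × at i ≡ u)
  index-from zero u = index u , z≤n , index< u , at-index u
  index-from (suc a) u with index-from a u
  ... | i , a≤i , i<a , eq with a <? i
  ... | yes a<i = i , a<i , m<n⇒m<1+n i<a , eq
  ... | no a≮i with ≤-antisym a≤i (≮⇒≥ a≮i)
  ... | refl = a + n , m<m+n a (m<n⇒0<n (index< u)) , n<1+n (a + n) , trans (at-per a) eq

  lower-index : ∀ {a i} → a + n ≤ i → ∃[ j ] (a ≤ j × j + n ≡ i)
  lower-index {a} {i} h = i ∸ n , +-cancelʳ-≤ n a (i ∸ n) (≤-trans h (≤-reflexive (sym eq))) , eq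
    where
    eq : i ∸ n + n ≡ i
    eq = m∸n+n≡m (≤-trans (m≤n+m n a) h)

  at-inj′ : ∀ {a i j} → a ≤ i → i < a + n → a ≤ j → j < a + n → at i ≡ at j → i ≡ j
  at-inj′ {a} {i} {j} a≤i i<a a≤j j<a eq with <-cmp i j
  ... | tri< i<j _ _ = contradiction eq (at-inj i<j (<-≤-trans j<a (+-monoˡ-≤ n a≤i)))
  ... | tri≈ _ h _ = h
  ... | tri> _ _ j<i = contradiction (sym eq) (at-inj j<i (<-≤-trans i<a (+-monoˡ-≤ n a≤j)))

-- `far` and `near` together exhaust the window from `x i` to `x i + n`, so they determine the whole
-- neighbourhood.
record Round {n : ℕ} (G : Graph n) : Set where
  field
    cycle : Cycle n
    dial : Dial n
  open Cycle cycle public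
  open Dial dial public
  field
    far : ∀ {i j} → x i ≤ j → j < y i → ¬ (N[ at i ] G) (at j)
    near : ∀ {i j} → y i ≤ j → j < x i + n → (N[ at i ] G) (at j)

module Ordered {n : ℕ} {G : Graph n} (R : Round G) (τ : CircOrd n) where
  open Round R

  private
    pos : ℕ → Fin n
    pos i = Inverse.to τ (at i)

    bet : ℕ → ℕ → ℕ → Bool
    bet i j k = between (toℕ (pos i)) (toℕ (pos j)) (toℕ (pos k))

  to-inj : ∀ {u v} → Inverse.to τ u ≡ Inverse.to τ v → u ≡ v
  to-inj {u} {v} eq = trans (sym (Inverse.strictlyInverseʳ τ u))
    (trans (cong (Inverse.from τ) eq) (Inverse.strictlyInverseʳ τ v))

  pos-per : ∀ i → pos (i + n) ≡ pos i
  pos-per i = cong (Inverse.to τ) (at-per i)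

  pos-inj : ∀ {i j} → i < j → j < i + n → pos i ≢ pos j
  pos-inj i<j j<i eq = at-inj i<j j<i (to-inj eq)

  -- No chord joining two of the positions p, …, q - 1 crosses, in the ordering τ, a
  -- chord joining two of the other positions.
  Convex : ℕ → ℕ → Set
  Convex p q = ∀ {a b c d} → p ≤ a → a < q → p ≤ b → b < q →
    q ≤ c → c < p + n → q ≤ d → d < p + n → bet a b c ≡ bet a b d

  bet-perʳ : ∀ a b c → bet a b (c + n) ≡ bet a b c
  bet-perʳ a b c = cong (λ k → between (toℕ (pos a)) (toℕ (pos b)) (toℕ k)) (pos-per c)

  bet-perˡ : ∀ a b c → bet (a + n) (b + n) c ≡ bet a b c
  bet-perˡ a b c = cong₂ (λ i j → between (toℕ i) (toℕ j) (toℕ (pos c))) (pos-per a) (pos-per b)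

  -- Symmetry of crossing exchanges the roles of an arc and its complement; positions from `p + n`
  -- on are read one turn lower.
  convex-compl : ∀ {p q} → p < q → q < p + n → Convex p q → Convex q (p + n)
  convex-compl {p} {q} p<q q<p conv {a} {b} {c} {d} q≤a a<p q≤b b<p p≤c c<q p≤d d<q
    with lower-index p≤c | lower-index p≤d
  ... | c′ , p≤c′ , refl | d′ , p≤d′ , refl =
    trans (bet-perʳ a b c′) (trans (between-transpose _ _ _ _ (apart p≤c′ c′<q q≤a a<p) (apart p≤d′ d′<q q≤a a<p)
      (apart p≤c′ c′<q q≤b b<p) (apart p≤d′ d′<q q≤b b<p)
      (conv p≤c′ c′<q p≤d′ d′<q q≤a a<p q≤b b<p)) (sym (bet-perʳ a b d′)))
    where
    c′<q : c′ < q
    c′<q = +-cancelʳ-< n c′ q c<q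
    d′<q : d′ < q
    d′<q = +-cancelʳ-< n d′ q d<q
    apart : ∀ {i j} → p ≤ i → i < q → q ≤ j → j < p + n → toℕ (pos i) ≢ toℕ (pos j)
    apart p≤i i<q q≤j j<p = pos-inj (<-≤-trans i<q q≤j) (<-≤-trans j<p (+-monoˡ-≤ n p≤i)) ∘ toℕ-injective

  convex-lower : ∀ {p q} → Convex (p + n) (q + n) → Convex p q
  convex-lower {p} {q} conv {a} {b} {c} {d} p≤a a<q p≤b b<q q≤c c<p q≤d d<p = begin
    bet a b c                     ≡⟨ bet-perˡ a b c ⟨
    bet (a + n) (b + n) c         ≡⟨ bet-perʳ (a + n) (b + n) c ⟨
    bet (a + n) (b + n) (c + n)   ≡⟨ conv (+-monoˡ-≤ n p≤a) (+-monoˡ-< n a<q) (+-monoˡ-≤ n p≤b) (+-monoˡ-< n b<q)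
                                       (+-monoˡ-≤ n q≤c) (+-monoˡ-< n c<p) (+-monoˡ-≤ n q≤d) (+-monoˡ-< n d<p) ⟩
    bet (a + n) (b + n) (d + n)   ≡⟨ bet-perʳ (a + n) (b + n) d ⟩
    bet (a + n) (b + n) d         ≡⟨ bet-perˡ a b d ⟩
    bet a b d                     ∎
    where open ≡-Reasoning

  -- Every outside position is compared with q′, which lies outside both arcs.
  convex-cap : ∀ {p q p′ q′} → p < p′ → p′ < q → q < q′ → q′ < p + n →
               Convex p q → Convex p′ q′ → Convex p′ q
  convex-cap {p} {q} {p′} {q′} p<p′ p′<q q<q′ q′<p conv conv′ {a} {b} {c} {d} p≤a a<q p≤b b<q q≤c c<p q≤d d<p =
    trans (to-q′ q≤c c<p) (sym (to-q′ q≤d d<p))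
    where
    to-q′ : ∀ {c} → q ≤ c → c < p′ + n → bet a b c ≡ bet a b q′
    to-q′ {c} q≤c c<p′ with c <? p + n
    ... | yes c<p = conv (≤-trans (<⇒≤ p<p′) p≤a) a<q (≤-trans (<⇒≤ p<p′) p≤b) b<q q≤c c<p (<⇒≤ q<q′) q′<p
    ... | no c≮p = conv′ p≤a (<-trans a<q q<q′) p≤b (<-trans b<q q<q′)
                     (≤-trans (<⇒≤ q′<p) (≮⇒≥ c≮p)) c<p′ ≤-refl (<-trans q′<p (+-monoˡ-< n p<p′))

  family : ChordFamily n Convex
  family = record { compl = convex-compl ; lower = convex-lower ; cap = convex-cap }

  convex-E : ArcOrdering G τ → ∀ w → Convex (x w) (y w)
  convex-E arc w x≤a a<y x≤b b<y y≤c c<x y≤d d<x =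
    separated _ (arc (at w)) (outside x≤a a<y) (outside x≤b b<y) (inside y≤c c<x) (inside y≤d d<x)
    where
    outside : ∀ {i} → x w ≤ i → i < y w → ¬ posSet τ (N[ at w ] G) (pos i)
    outside x≤i i<y h = far x≤i i<y (subst (N[ at w ] G) (Inverse.strictlyInverseʳ τ _) h)
    inside : ∀ {i} → y w ≤ i → i < x w + n → posSet τ (N[ at w ] G) (pos i)
    inside y≤i i<x = subst (N[ at w ] G) (sym (Inverse.strictlyInverseʳ τ _)) (near y≤i i<x)

  module _ {r s : ℕ} (link : Next (pos r) (pos s) ⊎ Next (pos s) (pos r)) where

    bet-link : ∀ {a b} → pos a ≢ pos r → pos a ≢ pos s → pos b ≢ pos r → pos b ≢ pos s → bet a b r ≡ bet a b s
    bet-link a≢r a≢s b≢r b≢s =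
      [ (λ h → between-next h a≢r a≢s b≢r b≢s) , (λ h → sym (between-next h a≢s a≢r b≢s b≢r)) ]′ link

    apart-window : ∀ {m i j} → m ≤ i → i < j → j < m + n → pos i ≢ pos j
    apart-window m≤i i<j j<m = pos-inj i<j (<-≤-trans j<m (+-monoˡ-≤ n m≤i))

    -- Every outside position is compared with `s`: those in `[p′, q)` by convexity of that arc,
    -- those from `q` on first with `r` and then with `s` across the link. Without the link nothing
    -- relates the two groups, as the given arcs do not cross.
    convex-diff-right : ∀ {p p′ q} → p < p′ → p′ < q → q < p + n → Convex p q → Convex p′ q →
                        q ≤ r → r < p + n → p′ ≤ s → s < q → Convex p p′
    convex-diff-right {p} {p′} {q} p<p′ p′<q q<p conv conv′ q≤r r<p p′≤s s<q {a} {b} {c} {d} p≤a a<p′ p≤b b<p′ p′≤c c<p p′≤d d<p =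
      trans (to-s p′≤c c<p) (sym (to-s p′≤d d<p))
      where
      to-s : ∀ {c} → p′ ≤ c → c < p + n → bet a b c ≡ bet a b s
      to-s {c} p′≤c c<p with c <? q
      ... | yes c<q = begin
        bet a b c                     ≡⟨ bet-perˡ a b c ⟨
        bet (a + n) (b + n) c         ≡⟨ bet-perʳ (a + n) (b + n) c ⟨
        bet (a + n) (b + n) (c + n)   ≡⟨ convex-compl p′<q (<-trans q<p (+-monoˡ-< n p<p′)) conv′
                                           (≤-trans (<⇒≤ q<p) (+-monoˡ-≤ n p≤a)) (+-monoˡ-< n a<p′)
                                           (≤-trans (<⇒≤ q<p) (+-monoˡ-≤ n p≤b)) (+-monoˡ-< n b<p′)
                                           (+-monoˡ-≤ n p′≤c) (+-monoˡ-< n c<q) (+-monoˡ-≤ n p′≤s) (+-monoˡ-< n s<q) ⟩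
        bet (a + n) (b + n) (s + n)   ≡⟨ bet-perʳ (a + n) (b + n) s ⟩
        bet (a + n) (b + n) s         ≡⟨ bet-perˡ a b s ⟩
        bet a b s                     ∎
        where open ≡-Reasoning
      ... | no c≮q = trans (conv p≤a (<-trans a<p′ p′<q) p≤b (<-trans b<p′ p′<q) (≮⇒≥ c≮q) c<p q≤r r<p)
        (bet-link (apart-window p≤a (<-≤-trans (<-trans a<p′ p′<q) q≤r) r<p) (apart-window p≤a (<-≤-trans a<p′ p′≤s) (<-trans s<q q<p))
                  (apart-window p≤b (<-≤-trans (<-trans b<p′ p′<q) q≤r) r<p) (apart-window p≤b (<-≤-trans b<p′ p′≤s) (<-trans s<q q<p)))

    convex-diff-left : ∀ {p q′ q} → p < q′ → q′ < q → q < p + n → Convex p q → Convex p q′ →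
                       q ≤ r → r < p + n → p ≤ s → s < q′ → Convex q′ q
    convex-diff-left {p} {q′} {q} p<q′ q′<q q<p conv conv′ q≤r r<p p≤s s<q′ {a} {b} {c} {d} q′≤a a<q q′≤b b<q q≤c c<q′ q≤d d<q′ =
      trans (to-s q≤c c<q′) (sym (to-s q≤d d<q′))
      where
      to-s : ∀ {c} → q ≤ c → c < q′ + n → bet a b c ≡ bet a b s
      to-s {c} q≤c c<q′ with c <? p + n
      ... | yes c<p = trans (conv (≤-trans (<⇒≤ p<q′) q′≤a) a<q (≤-trans (<⇒≤ p<q′) q′≤b) b<q q≤c c<p q≤r r<p)
        (bet-link (apart-window (≤-trans (<⇒≤ p<q′) q′≤a) (<-≤-trans a<q q≤r) r<p)
                  (≢-sym (apart-window p≤s (<-≤-trans s<q′ q′≤a) (<-trans a<q q<p)))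
                  (apart-window (≤-trans (<⇒≤ p<q′) q′≤b) (<-≤-trans b<q q≤r) r<p)
                  (≢-sym (apart-window p≤s (<-≤-trans s<q′ q′≤b) (<-trans b<q q<p))))
      ... | no c≮p = trans
        (convex-compl p<q′ (<-trans q′<q q<p) conv′ q′≤a (<-trans a<q q<p) q′≤b (<-trans b<q q<p)
          (≮⇒≥ c≮p) c<q′ (+-monoˡ-≤ n p≤s) (+-monoˡ-< n s<q′))
        (bet-perʳ a b s)

  pair-next : ∀ a → 2 ≤ n → Convex a (2 + a) → Next (pos a) (pos (suc a)) ⊎ Next (pos (suc a)) (pos a)
  pair-next a 2≤n conv = neighbours (pos-inj (n<1+n a) sa<a+n) alike
    where
    sa<a+n : suc a < a + n
    sa<a+n = subst (suc (suc a) ≤_) (+-comm n a) (+-monoˡ-≤ a 2≤n)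
    locate : ∀ c → c ≢ pos a → c ≢ pos (suc a) → ∃[ i ] (2 + a ≤ i × i < a + n × pos i ≡ c)
    locate c c≢a c≢sa with index-from a (Inverse.from τ c)
    ... | i , a≤i , i<a , eq with a ≟ i
    ... | yes refl = contradiction (trans (sym (Inverse.strictlyInverseˡ τ c)) (cong (Inverse.to τ) (sym eq))) c≢a
    ... | no a≢i with suc a ≟ i
    ... | yes refl = contradiction (trans (sym (Inverse.strictlyInverseˡ τ c)) (cong (Inverse.to τ) (sym eq))) c≢sa
    ... | no sa≢i = i , ≤∧≢⇒< (≤∧≢⇒< a≤i a≢i) sa≢i , i<a , trans (cong (Inverse.to τ) eq) (Inverse.strictlyInverseˡ τ c)
    alike : Alike (pos a) (pos (suc a))
    alike c d c≢ c≢′ d≢ d≢′ with locate c c≢ c≢′ | locate d d≢ d≢′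
    ... | i , a≤i , i<a , refl | j , a≤j , j<a , refl =
      conv ≤-refl (m<n⇒m<1+n (n<1+n a)) (n≤1+n a) (n<1+n (suc a)) a≤i i<a a≤j j<a

-- Successor relations and orderings given by listings

module _ {n : ℕ} (τ : CircOrd n) where
  open Inverse τ

  Follow : Fin n → Fin n → Set
  Follow u w = Next (to u) (to w)

  follow-succV : ∀ {u w} → Follow u w → succV τ u ≡ w
  follow-succV {u} {w} h = trans (cong from (next-sucC h)) (strictlyInverseʳ w)

  follow-predV : ∀ {u w} → Follow u w → predV τ w ≡ u
  follow-predV {u} {w} h = trans (cong from (next-predC h)) (strictlyInverseʳ u)

  succV-follow : ∀ u → Follow u (succV τ u)
  succV-follow u = subst (Next (to u)) (sym (strictlyInverseˡ _)) (next-of-sucC (to u))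

  predV-follow : ∀ u → Follow (predV τ u) u
  predV-follow u = subst (λ p → Next p (to u)) (sym (strictlyInverseˡ _)) (next-of-predC (to u))

  follow-functional : ∀ {u w w′} → Follow u w → Follow u w′ → w ≡ w′
  follow-functional h h′ = trans (sym (follow-succV h)) (follow-succV h′)

  follow-injective : ∀ {u u′ w} → Follow u w → Follow u′ w → u ≡ u′
  follow-injective h h′ = trans (sym (follow-predV h)) (follow-predV h′)

module _ {n : ℕ} (σ τ : CircOrd n) where

  same-direction : (∀ {u w} → Follow σ u w → Follow τ u w) → SameUpToReversal σ τ
  same-direction f = inj₁ λ u → follow-succV τ (f (succV-follow σ u))

  opposite-direction : (∀ {u w} → Follow σ u w → Follow τ w u) → SameUpToReversal σ τ
  opposite-direction f = inj₂ λ u → follow-succV τ (f (predV-follow σ u))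

module Paths {n : ℕ} (3≤n : 3 ≤ n) (at : ℕ → Fin n)
    (at-inj : ∀ {i j} → i < j → j < i + n → at i ≢ at j) (τ : CircOrd n) where

  Fwd Bwd : ℕ → Set
  Fwd a = Follow τ (at a) (at (suc a))
  Bwd a = Follow τ (at (suc a)) (at a)

  at-2+ : ∀ a → at a ≢ at (2 + a)
  at-2+ a = at-inj (m<n⇒m<1+n (n<1+n a)) (subst (3 + a ≤_) (+-comm n a) (+-monoˡ-≤ a 3≤n))

  module _ (l m : ℕ) (links : ∀ a → l ≤ a → suc a < m → Fwd a ⊎ Bwd a) where

    -- A change of direction would give the vertex in the middle two predecessors, which `at-2+`
    -- shows to be distinct.
    propagate-fwd : Fwd l → ∀ i → suc (i + l) < m → Fwd (i + l)
    propagate-fwd f zero h = f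
    propagate-fwd f (suc i) h with links (suc (i + l)) (m≤n+m l (suc i)) h
    ... | inj₁ k = k
    ... | inj₂ k = contradiction (follow-injective τ (propagate-fwd f i (<-trans (n<1+n _) h)) k) (at-2+ (i + l))

    propagate-bwd : Bwd l → ∀ i → suc (i + l) < m → Bwd (i + l)
    propagate-bwd f zero h = f
    propagate-bwd f (suc i) h with links (suc (i + l)) (m≤n+m l (suc i)) h
    ... | inj₁ k = contradiction (follow-functional τ (propagate-bwd f i (<-trans (n<1+n _) h)) k) (at-2+ (i + l))
    ... | inj₂ k = k

    direction : suc l < m → (∀ a → l ≤ a → suc a < m → Fwd a) ⊎ (∀ a → l ≤ a → suc a < m → Bwd a)
    direction h with links l ≤-refl h
    ... | inj₁ f = inj₁ λ a l≤a a<m → subst Fwd (m∸n+n≡m l≤a)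
            (propagate-fwd f (a ∸ l) (subst (λ k → suc k < m) (sym (m∸n+n≡m l≤a)) a<m))
    ... | inj₂ f = inj₂ λ a l≤a a<m → subst Bwd (m∸n+n≡m l≤a)
            (propagate-bwd f (a ∸ l) (subst (λ k → suc k < m) (sym (m∸n+n≡m l≤a)) a<m))

record Listing (n : ℕ) : Set where
  field
    seq : ℕ → Fin n
    seq-inj : ∀ {i j} → i < j → j < n → seq i ≢ seq j
    index : Fin n → ℕ
    index< : ∀ u → index u < n
    seq-index : ∀ u → seq (index u) ≡ u

  seq-inj′ : ∀ {i j} → i < n → j < n → seq i ≡ seq j → i ≡ j
  seq-inj′ {i} {j} i<n j<n eq with <-cmp i j
  ... | tri< i<j _ _ = contradiction eq (seq-inj i<j j<n)
  ... | tri≈ _ h _ = h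
  ... | tri> _ _ j<i = contradiction (sym eq) (seq-inj j<i i<n)

  index-seq : ∀ {i} → i < n → index (seq i) ≡ i
  index-seq {i} i<n = seq-inj′ (index< (seq i)) i<n (seq-index (seq i))

  order : CircOrd n
  order = mk↔ₛ′ (λ u → fromℕ< (index< u)) (λ p → seq (toℕ p))
    (λ p → toℕ-injective (trans (toℕ-fromℕ< _) (index-seq (toℕ<n p))))
    (λ u → trans (cong seq (toℕ-fromℕ< _)) (seq-index u))

  to-seq : ∀ {i} → i < n → toℕ (Inverse.to order (seq i)) ≡ i
  to-seq i<n = trans (toℕ-fromℕ< _) (index-seq i<n)

  follow-seq : ∀ {i} → suc i < n → Follow order (seq i) (seq (suc i))
  follow-seq h = inj₁ (trans (to-seq h) (cong suc (sym (to-seq (<-trans (n<1+n _) h)))))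

  follow-wrap : ∀ {i} → suc i ≡ n → Follow order (seq i) (seq 0)
  follow-wrap refl = inj₂ (to-seq (s≤s z≤n) , cong suc (to-seq ≤-refl))

  follow-seq⁻ : ∀ {u w} → Follow order u w →
    (∃[ i ] (suc i < n × seq i ≡ u × seq (suc i) ≡ w)) ⊎ (∃[ i ] (suc i ≡ n × seq i ≡ u × seq 0 ≡ w))
  follow-seq⁻ {u} {w} h with suc (index u) <? n
  ... | yes k = inj₁ (index u , k , seq-index u
    , follow-functional order (follow-seq k) (subst (λ v → Follow order v w) (sym (seq-index u)) h))
  ... | no k = inj₂ (index u , last , seq-index u
    , follow-functional order (follow-wrap last) (subst (λ v → Follow order v w) (sym (seq-index u)) h))
    where
    last : suc (index u) ≡ n
    last = ≤-antisym (index< u) (≮⇒≥ k)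

module CycleOrder {n : ℕ} (C : Cycle n) where
  open Cycle C

  listing : Listing n
  listing = record { seq = at ; seq-inj = λ {i} i<j j<n → at-inj i<j (<-≤-trans j<n (m≤n+m n i))
                   ; index = index ; index< = index< ; seq-index = at-index }
  open Listing listing public using (order)
  open Listing listing using (follow-seq⁻)

  follow⁻ : ∀ {u w} → Follow order u w → ∃[ i ] (i < n × at i ≡ u × at (suc i) ≡ w)
  follow⁻ h with follow-seq⁻ h
  ... | inj₁ (i , i<n , eq , eq′) = i , <-trans (n<1+n i) i<n , eq , eq′
  ... | inj₂ (i , refl , eq , eq′) = i , ≤-refl , eq , trans (at-per 0) eq′

  same-order : (3≤n : 3 ≤ n) (τ : CircOrd n) →
    (∀ a → Follow τ (at a) (at (suc a)) ⊎ Follow τ (at (suc a)) (at a)) → SameUpToReversal order τ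
  -- The bound `2 + n` takes in the closing link from `at (n - 1)` to `at n`, which is `at 0`.
  same-order 3≤n τ links with Paths.direction 3≤n at at-inj τ 0 (2 + n) (λ a _ _ → links a) (s≤s (s≤s z≤n))
  ... | inj₁ f = same-direction order τ λ h → go (follow⁻ h)
    where
    go : ∀ {u w} → ∃[ i ] (i < n × at i ≡ u × at (suc i) ≡ w) → Follow τ u w
    go (i , i<n , refl , refl) = f i z≤n (m<n⇒m<1+n (s≤s i<n))
  ... | inj₂ f = opposite-direction order τ λ h → go (follow⁻ h)
    where
    go : ∀ {u w} → ∃[ i ] (i < n × at i ≡ u × at (suc i) ≡ w) → Follow τ w u
    go (i , i<n , refl , refl) = f i z≤n (m<n⇒m<1+n (s≤s i<n))

-- From a proper circular-arc model to a round ordering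

least : ∀ {P : ℕ → Set} → (∀ k → Dec (P k)) → ∀ b → P b → ∃[ k ] (P k × (∀ {j} → P j → k ≤ j))
least P? zero p = 0 , p , λ _ → z≤n
least P? (suc b) p with P? 0
... | yes p₀ = 0 , p₀ , λ _ → z≤n
... | no ¬p₀ with least (P? ∘ suc) b p
... | k , pk , min = suc k , pk , λ { {zero} p₀ → contradiction p₀ ¬p₀ ; {suc j} pj → s≤s (min pj) }

N-sym : ∀ {n} {G : Graph n} {u v} → (N[ u ] G) v → (N[ v ] G) u
N-sym (inj₁ eq) = inj₁ (sym eq)
N-sym {G = G} {u} {v} (inj₂ adj) = inj₂ (trans (Graph.sym G v u) adj)

-- Lifts S i < E i < S (i + n) of the endpoints of the arcs of a proper circular-arc
-- model, listed in cyclic order.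
record ArcModel {n : ℕ} (G : Graph n) : Set where
  field
    cycle : Cycle n
  open Cycle cycle public
  field
    m : ℕ
    S E : ℕ → ℕ
    S-per : ∀ i → S (i + n) ≡ S i + m
    E-per : ∀ i → E (i + n) ≡ E i + m
    S-mono : ∀ {i j} → i < j → S i < S j
    E-mono : ∀ {i j} → i < j → E i < E j
    S<E : ∀ i → S i < E i
    E<S : ∀ i → E i < S (i + n)
    adj⇒ : ∀ {i j} → i < j → j < i + n → Adj G (at i) (at j) → S j < E i ⊎ S (i + n) < E j
    adj⇐ : ∀ {i j} → i < j → j < i + n → S j < E i ⊎ S (i + n) < E j → Adj G (at i) (at j)

  S-mono-≤ : ∀ {i j} → i ≤ j → S i ≤ S j
  S-mono-≤ {i} {j} i≤j with m≤n⇒m<n∨m≡n i≤j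
  ... | inj₁ h = <⇒≤ (S-mono h)
  ... | inj₂ refl = ≤-refl

  E-mono-≤ : ∀ {i j} → i ≤ j → E i ≤ E j
  E-mono-≤ {i} {j} i≤j with m≤n⇒m<n∨m≡n i≤j
  ... | inj₁ h = <⇒≤ (E-mono h)
  ... | inj₂ refl = ≤-refl

  first-beyond : ∀ i → ∃[ k ] (E i ≤ S k × (∀ {j} → E i ≤ S j → k ≤ j))
  first-beyond i = least (λ k → E i ≤? S k) (i + n) (<⇒≤ (E<S i))

  x : ℕ → ℕ
  x i = proj₁ (first-beyond i)

  x-min : ∀ {i j} → E i ≤ S j → x i ≤ j
  x-min {i} = proj₂ (proj₂ (first-beyond i))

  x-reach : ∀ {i j} → x i ≤ j → E i ≤ S j
  x-reach {i} h = ≤-trans (proj₁ (proj₂ (first-beyond i))) (S-mono-≤ h)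

  x-mono : ∀ {i j} → i ≤ j → x i ≤ x j
  x-mono i≤j = x-min (≤-trans (E-mono-≤ i≤j) (x-reach ≤-refl))

  i<x : ∀ i → i < x i
  i<x i = ≰⇒> (λ h → <⇒≱ (S<E i) (x-reach h))

  x≤ : ∀ i → x i ≤ i + n
  x≤ i = x-min (<⇒≤ (E<S i))

  x-per : ∀ i → x (i + n) ≡ x i + n
  x-per i = ≤-antisym
    (x-min (subst₂ _≤_ (sym (E-per i)) (sym (S-per (x i))) (+-monoˡ-≤ m (x-reach {i} ≤-refl))))
    (subst (x i + n ≤_) k≡ (+-monoˡ-≤ n (x-min (+-cancelʳ-≤ m _ _
      (subst₂ _≤_ (E-per i) (trans (cong S (sym k≡)) (S-per k′)) (x-reach {i + n} ≤-refl))))))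
    where
    k′ = x (i + n) ∸ n
    k≡ : k′ + n ≡ x (i + n)
    k≡ = m∸n+n≡m (≤-trans (m≤n+m n i) (<⇒≤ (i<x (i + n))))

  first-around : ∀ i → ∃[ k ] (i + n < x k × (∀ {j} → i + n < x j → k ≤ j))
  first-around i = least (λ k → i + n <? x k) (i + n) (i<x (i + n))

  -- Defined from `x` by the duality itself, so that `gal₁` and `gal₂` come for free; that
  -- `[x i, y i)` is the co-neighbourhood is then to be shown.
  y : ℕ → ℕ
  y i = proj₁ (first-around i)

  gal₁ : ∀ {u k} → y u ≤ k → u + n < x k
  gal₁ {u} h = <-≤-trans (proj₁ (proj₂ (first-around u))) (x-mono h)

  gal₂ : ∀ {u k} → u + n < x k → y u ≤ k
  gal₂ {u} = proj₂ (proj₂ (first-around u))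

  close : ∀ {i j} → i ≤ j → j < x i → (N[ at i ] G) (at j)
  close {i} {j} i≤j j<x with m≤n⇒m<n∨m≡n i≤j
  ... | inj₁ i<j = inj₂ (adj⇐ i<j (<-≤-trans j<x (x≤ i)) (inj₁ (≰⇒> (λ h → <⇒≱ j<x (x-min h)))))
  ... | inj₂ refl = inj₁ refl

  close-back : ∀ {i j} → i < j → j < i + n → i + n < x j → (N[ at i ] G) (at j)
  close-back {i} {j} i<j j<i h = inj₂ (adj⇐ i<j j<i (inj₂ (≰⇒> (λ k → <⇒≱ h (x-min k)))))

  module _ (2≤n : 2 ≤ n) (twin-free : TwinFree G) where

    -- Arcs meeting at both ends cover the circle, so their vertices would be universal twins.
    meets-once : ∀ {i j} → i < j → j < x i → ¬ (i + n < x j)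
    meets-once {i} {j} i<j j<x i<x = twin-free (at i) (at j) (at-inj i<j j<i)
      (λ w → mk⇔ (λ _ → all-j w) (λ _ → all-i w))
      where
      j<i : j < i + n
      j<i = <-≤-trans j<x (x≤ i)
      all-i : ∀ w → (N[ at i ] G) w
      all-i w with index-from i w
      ... | l , i≤l , l<i , refl with l <? x i
      ... | yes l<x = close i≤l l<x
      ... | no l≮x = close-back (<-trans i<j (<-≤-trans j<x (≮⇒≥ l≮x))) l<i (<-≤-trans i<x (x-mono (<⇒≤ (<-≤-trans j<x (≮⇒≥ l≮x)))))
      all-j : ∀ w → (N[ at j ] G) w
      all-j w with index-from i w
      ... | l , i≤l , l<i , refl with l <? j
      ... | yes l<j = N-sym {G = G} (close (<⇒≤ l<j) (<-≤-trans j<x (x-mono i≤l)))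
      ... | no l≮j = close (≮⇒≥ l≮j) (<-trans l<i i<x)

    -- Otherwise the arcs of `i` and `y i` would meet at both ends.
    x≤y : ∀ i → x i ≤ y i
    x≤y i = ≮⇒≥ λ y<x → meets-once
      (≰⇒> λ y≤i → <⇒≱ (gal₁ {i} y≤i) (x≤ i)) y<x (gal₁ {i} ≤-refl)

    dial : Dial n
    dial = record { x = x ; y = y ; x-mono = x-mono ; x-per = x-per ; i<x = i<x ; x≤y = x≤y
                  ; gal₁ = λ {u} → gal₁ {u} ; gal₂ = gal₂ }

    far : ∀ {i j} → x i ≤ j → j < y i → ¬ (N[ at i ] G) (at j)
    far {i} {j} x≤j j<y h with <-≤-trans (i<x i) x≤j | <-≤-trans j<y (Dial.y≤ dial i) | h
    ... | i<j | j<i | inj₁ eq = at-inj i<j j<i (sym eq)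
    ... | i<j | j<i | inj₂ adj with adj⇒ i<j j<i adj
    ... | inj₁ k = <⇒≱ k (x-reach x≤j)
    ... | inj₂ k = <⇒≱ k (x-reach (Dial.gal₃ dial j<y))

    near : ∀ {i j} → y i ≤ j → j < x i + n → (N[ at i ] G) (at j)
    near {i} {j} y≤j j<x with <-cmp j (i + n)
    ... | tri< j<i _ _ = close-back (<-≤-trans (Dial.i<y dial i) y≤j) j<i (gal₁ {i} y≤j)
    ... | tri≈ _ refl _ = inj₁ (at-per i)
    ... | tri> _ _ i<j = subst (N[ at i ] G) (trans (sym (at-per (j ∸ n))) (cong at j≡))
      (close (+-cancelʳ-≤ n _ _ (subst (i + n ≤_) (sym j≡) (<⇒≤ i<j))) (+-cancelʳ-< n _ _ (subst (_< x i + n) (sym j≡) j<x)))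
      where
      j≡ : j ∸ n + n ≡ j
      j≡ = m∸n+n≡m (≤-trans (m≤n+m n i) (<⇒≤ i<j))

    round : Round G
    round = record { cycle = cycle ; dial = dial ; far = far ; near = near }

-- A nonempty proper arc as `[s, e)` on the universal cover, with its start in the first turn. The
-- second alternative of membership concerns the lift `p + m`.
record LiftedArc {m : ℕ} (A : Fin m → Set) : Set where
  field
    s e : ℕ
    s<m : s < m
    s<e : s < e
    e<s+m : e < s + m
    mem⇒ : ∀ {p} → A p → (s ≤ toℕ p × toℕ p < e) ⊎ toℕ p + m < e
    mem⇐ : ∀ {p} → (s ≤ toℕ p × toℕ p < e) ⊎ toℕ p + m < e → A p

liftArc : ∀ {m} {A : Fin m → Set} → IsArc m A → ∃[ p ] A p → ¬ (∀ p → A p) → LiftedArc A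
liftArc {m} {A} (a , b , a≤b , b≤m , inj₁ f) (p₀ , h₀) proper = record
  { s = a ; e = b ; s<m = <-≤-trans a<b b≤m ; s<e = a<b ; e<s+m = b<a+m
  ; mem⇒ = λ {p} h → inj₁ (Equivalence.to (f p) h)
  ; mem⇐ = λ {p} → [ Equivalence.from (f p) , (λ h → contradiction (≤-trans b≤m (m≤n+m m _)) (<⇒≱ h)) ]′ }
  where
  a<b : a < b
  a<b = ≤-<-trans (proj₁ (Equivalence.to (f p₀) h₀)) (proj₂ (Equivalence.to (f p₀) h₀))
  b<a+m : b < a + m
  b<a+m = ≰⇒> λ h → proper λ p → Equivalence.from (f p)
    ( ≤-trans (+-cancelʳ-≤ m a 0 (≤-trans h b≤m)) z≤n
    , <-≤-trans (toℕ<n p) (≤-trans (m≤n+m m a) h))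
liftArc {m} {A} (a , b , a≤b , b≤m , inj₂ f) (p₀ , h₀) proper with b <? m
... | yes b<m = record
  { s = b ; e = a + m ; s<m = b<m ; s<e = <-≤-trans b<m (m≤n+m m a) ; e<s+m = +-monoˡ-< m a<b
  ; mem⇒ = λ {p} h → mem p h
  ; mem⇐ = λ {p} → [ (λ h → Equivalence.from (f p) λ k → <⇒≱ (proj₂ k) (proj₁ h))
                   , (λ h → Equivalence.from (f p) λ k → <⇒≱ (+-cancelʳ-< m _ _ h) (proj₁ k)) ]′ }
  where
  a<b : a < b
  a<b = ≰⇒> λ b≤a → proper λ p → Equivalence.from (f p) (λ k → <⇒≱ (<-≤-trans (proj₂ k) b≤a) (proj₁ k))
  mem : ∀ p → A p → (b ≤ toℕ p × toℕ p < a + m) ⊎ toℕ p + m < a + m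
  mem p h with b ≤? toℕ p
  ... | yes k = inj₁ (k , <-≤-trans (toℕ<n p) (m≤n+m m a))
  ... | no k = inj₂ (+-monoˡ-< m (≰⇒> λ a≤p → Equivalence.to (f p) h (a≤p , ≰⇒> k)))
-- Here the interval removed runs to the last point. The start is taken to be 0 instead of `b = m`,
-- to keep `s < m`.
... | no b≮m = record
  { s = 0 ; e = a ; s<m = ≤-<-trans z≤n (toℕ<n p₀) ; s<e = ≤-<-trans z≤n (below p₀ h₀) ; e<s+m = <-≤-trans a<b b≤m
  ; mem⇒ = λ {p} h → inj₁ (z≤n , below p h)
  ; mem⇐ = λ {p} → [ (λ h → Equivalence.from (f p) λ k → <⇒≱ (proj₂ h) (proj₁ k))
                   , (λ h → contradiction (≤-trans (≤-trans a≤b b≤m) (m≤n+m m _)) (<⇒≱ h)) ]′ }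
  where
  a<b : a < b
  a<b = ≰⇒> λ b≤a → proper λ p → Equivalence.from (f p) (λ k → <⇒≱ (<-≤-trans (proj₂ k) b≤a) (proj₁ k))
  below : ∀ p → A p → toℕ p < a
  below p h = ≰⇒> λ k → Equivalence.to (f p) h (k , <-≤-trans (toℕ<n p) (≮⇒≥ b≮m))

module TwoArcs {m : ℕ} {A B : Fin m → Set} (LA : LiftedArc A) (LB : LiftedArc B)
    (A⊈B : ¬ (∀ p → A p → B p)) (B⊈A : ¬ (∀ p → B p → A p)) where
  private
    module A = LiftedArc LA
    module B = LiftedArc LB

  -- Arcs with a common start are nested.
  starts-differ : A.s ≢ B.s
  starts-differ eq with A.e ≤? B.e
  ... | yes h = A⊈B λ p k → B.mem⇐ ([ (λ z → inj₁ (subst (_≤ toℕ p) eq (proj₁ z) , <-≤-trans (proj₂ z) h))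
                                     , (λ z → inj₂ (<-≤-trans z h)) ]′ (A.mem⇒ k))
  ... | no h = B⊈A λ p k → A.mem⇐ ([ (λ z → inj₁ (subst (_≤ toℕ p) (sym eq) (proj₁ z) , <-trans (proj₂ z) (≰⇒> h)))
                                    , (λ z → inj₂ (<-trans z (≰⇒> h))) ]′ (B.mem⇒ k))

  module _ (s<s : A.s < B.s) where

    ends-increase : A.e < B.e
    ends-increase = ≰⇒> λ h → B⊈A λ p k → A.mem⇐
      ([ (λ z → inj₁ (≤-trans (<⇒≤ s<s) (proj₁ z) , <-≤-trans (proj₂ z) h))
       , (λ z → inj₂ (<-≤-trans z h)) ]′ (B.mem⇒ k))

    -- Otherwise the second arc would contain the first one lifted by a turn.
    ends-wrap : B.e < A.e + m
    ends-wrap = ≰⇒> λ h → A⊈B λ p k → B.mem⇐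
      ([ (λ z → inj₂ (<-≤-trans (+-monoˡ-< m (proj₂ z)) h))
       , (λ z → inj₂ (<-trans z (<-≤-trans (m<m+n A.e (≤-<-trans z≤n A.s<m)) h))) ]′ (A.mem⇒ k))

    meet⇒ : ∃[ p ] (A p × B p) → B.s < A.e ⊎ A.s + m < B.e
    meet⇒ (p , a , b) with A.mem⇒ a | B.mem⇒ b
    ... | inj₁ (_ , p<e) | inj₁ (s≤p , _) = inj₁ (≤-<-trans s≤p p<e)
    ... | inj₁ (s≤p , _) | inj₂ p<e = inj₂ (≤-<-trans (+-monoˡ-≤ m s≤p) p<e)
    ... | inj₂ p<e | _ = inj₁ (<-trans (<-≤-trans B.s<m (m≤n+m m (toℕ p))) p<e)

    meet⇐ : B.s < A.e ⊎ A.s + m < B.e → ∃[ p ] (A p × B p)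
    meet⇐ (inj₁ h) = fromℕ< B.s<m
      , A.mem⇐ (inj₁ (≤-trans (<⇒≤ s<s) (≤-reflexive (sym (toℕ-fromℕ< _))) , subst (_< A.e) (sym (toℕ-fromℕ< _)) h))
      , B.mem⇐ (inj₁ (≤-reflexive (sym (toℕ-fromℕ< _)) , subst (_< B.e) (sym (toℕ-fromℕ< _)) B.s<e))
    meet⇐ (inj₂ h) = fromℕ< A.s<m
      , A.mem⇐ (inj₁ (≤-reflexive (sym (toℕ-fromℕ< _)) , subst (_< A.e) (sym (toℕ-fromℕ< _)) A.s<e))
      , B.mem⇐ (inj₂ (subst (λ k → k + m < B.e) (sym (toℕ-fromℕ< _)) h))

argmin : ∀ {n} (f : Fin (suc n) → ℕ) → ∃[ u ] (∀ v → f u ≤ f v)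
argmin {zero} f = Fin.zero , λ { Fin.zero → ≤-refl }
argmin {suc n} f with argmin (f ∘ Fin.suc)
... | u , min with f Fin.zero ≤? f (Fin.suc u)
... | yes h = Fin.zero , λ { Fin.zero → ≤-refl ; (Fin.suc v) → ≤-trans h (min v) }
... | no h = Fin.suc u , λ { Fin.zero → ≰⇒≥ h ; (Fin.suc v) → min v }

record Sorted {n : ℕ} (f : Fin n → ℕ) : Set where
  field
    nth : Fin n → Fin n
    nth-mono : ∀ {i j} → toℕ i < toℕ j → f (nth i) < f (nth j)
    rank : Fin n → Fin n
    nth-rank : ∀ u → nth (rank u) ≡ u

sort : ∀ {n} (f : Fin n → ℕ) → (∀ {u v} → u ≢ v → f u ≢ f v) → Sorted f
sort {zero} f inj = record { nth = λ () ; nth-mono = λ {i} → contradiction i (λ ()) ; rank = λ () ; nth-rank = λ () }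
sort {suc n} f inj with argmin f
... | u , min = record { nth = nth ; nth-mono = λ {i} {j} → mono i j ; rank = λ v → proj₁ (find v) ; nth-rank = λ v → proj₂ (find v) }
  where
  rest : Sorted (f ∘ punchIn u)
  rest = sort (f ∘ punchIn u) (λ i≢j → inj (i≢j ∘ punchIn-injective u _ _))
  module Rest = Sorted rest
  nth : Fin (suc n) → Fin (suc n)
  nth Fin.zero = u
  nth (Fin.suc i) = punchIn u (Rest.nth i)
  mono : ∀ i j → toℕ i < toℕ j → f (nth i) < f (nth j)
  mono Fin.zero (Fin.suc j) h = ≤∧≢⇒< (min _) (inj (punchInᵢ≢i u _ ∘ sym))
  mono (Fin.suc i) (Fin.suc j) h = Rest.nth-mono (s≤s⁻¹ h)
  find : ∀ v → ∃[ i ] nth i ≡ v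
  find v with u ≟ᶠ v
  ... | yes eq = Fin.zero , eq
  ... | no u≢v = Fin.suc (Rest.rank (punchOut u≢v)) , trans (cong (punchIn u) (Rest.nth-rank _)) (punchIn-punchOut u≢v)

module Model {n-1 : ℕ} {G : Graph (suc n-1)} {m : ℕ} (A : Fin (suc n-1) → Fin m → Set)
    (L : ∀ v → LiftedArc (A v))
    (adj : ∀ u v → u ≢ v → (Adj G u v ⇔ (∃[ p ] (A u p × A v p))))
    (incomparable : ∀ u v → u ≢ v → ¬ (∀ p → A u p → A v p)) where
  private
    n = suc n-1
    module L (v : Fin n) = LiftedArc (L v)
    module Two {u v : Fin n} (u≢v : u ≢ v) = TwoArcs (L u) (L v) (incomparable u v u≢v) (incomparable v u (u≢v ∘ sym))

  sorted : Sorted L.s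
  sorted = sort L.s (λ u≢v → Two.starts-differ u≢v)
  open Sorted sorted

  nth-inj : ∀ {i j} → toℕ i < toℕ j → nth i ≢ nth j
  nth-inj h eq = <⇒≢ (nth-mono h) (cong L.s eq)

  e-wrap : ∀ u v → L.e u < L.e v + m
  e-wrap u v with u ≟ᶠ v
  ... | yes refl = m<m+n (L.e u) (≤-<-trans z≤n (L.s<m u))
  ... | no u≢v with <-cmp (L.s u) (L.s v)
  ... | tri< h _ _ = <-≤-trans (Two.ends-increase u≢v h) (m≤m+n (L.e v) m)
  ... | tri≈ _ h _ = contradiction h (Two.starts-differ u≢v)
  ... | tri> _ _ h = Two.ends-wrap (u≢v ∘ sym) h

  residue : ℕ → Fin n
  residue i = i mod n

  quotient : ℕ → ℕ
  quotient i = i / n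

  residue-per : ∀ i → residue (i + n) ≡ residue i
  residue-per i = toℕ-injective (trans (toℕ-fromℕ< _) (trans ([m+n]%n≡m%n i n) (sym (toℕ-fromℕ< _))))

  quotient-per : ∀ i → quotient (i + n) ≡ suc (quotient i)
  quotient-per i = trans (+-distrib-/-∣ʳ i (∣-refl {n})) (trans (cong (i / n +_) (n/n≡1 n)) (+-comm (i / n) 1))

  Lex : ℕ → ℕ → Set
  Lex i j = (quotient i ≡ quotient j × toℕ (residue i) < toℕ (residue j)) ⊎ quotient i < quotient j

  lex : ∀ {i j} → i < j → Lex i j
  lex {i} {j} i<j with m≤n⇒m<n∨m≡n (/-monoˡ-≤ n (<⇒≤ i<j))
  ... | inj₁ h = inj₂ h
  ... | inj₂ h = inj₁ (h , subst₂ _<_ (sym (toℕ-fromℕ< _)) (sym (toℕ-fromℕ< _))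
      (+-cancelʳ-< (quotient j * n) _ _
        (subst₂ _<_ (trans (m≡m%n+[m/n]*n i n) (cong (λ k → i % n + k * n) h)) (m≡m%n+[m/n]*n j n) i<j)))

  -- In the second case the later position has the earlier start within its turn, so facts about two
  -- arcs have to be applied with their roles exchanged.
  lex-window : ∀ {i j} → i < j → j < i + n →
    (quotient j ≡ quotient i × toℕ (residue i) < toℕ (residue j)) ⊎
    (quotient j ≡ suc (quotient i) × toℕ (residue j) < toℕ (residue i))
  lex-window {i} {j} i<j j<i with lex i<j | lex j<i
  ... | inj₁ (q , r) | _ = inj₁ (sym q , r)
  ... | inj₂ _ | inj₁ (q , r) = inj₂ (trans q (quotient-per i) , subst (λ k → toℕ (residue j) < toℕ k) (residue-per i) r)
  ... | inj₂ q | inj₂ q′ = contradiction (subst (quotient j <_) (quotient-per i) q′) (≤⇒≯ q)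

  at : ℕ → Fin n
  at i = nth (residue i)

  S E : ℕ → ℕ
  S i = quotient i * m + L.s (at i)
  E i = quotient i * m + L.e (at i)

  lift-per : ∀ (f : Fin n → ℕ) i → quotient (i + n) * m + f (at (i + n)) ≡ quotient i * m + f (at i) + m
  lift-per f i = begin
    quotient (i + n) * m + f (at (i + n)) ≡⟨ cong₂ (λ q r → q * m + f (nth r)) (quotient-per i) (residue-per i) ⟩
    m + quotient i * m + f (at i)         ≡⟨ +-assoc m (quotient i * m) (f (at i)) ⟩
    m + (quotient i * m + f (at i))       ≡⟨ +-comm m _ ⟩
    quotient i * m + f (at i) + m         ∎
    where open ≡-Reasoning

  next-level : ∀ q {a b} → a < b + m → q * m + a < suc q * m + b
  next-level q {a} {b} h = subst (q * m + a <_) eq (+-monoʳ-< (q * m) h)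
    where
    eq : q * m + (b + m) ≡ suc q * m + b
    eq = trans (cong (q * m +_) (+-comm b m)) (trans (sym (+-assoc (q * m) m b)) (cong (_+ b) (+-comm (q * m) m)))

  next-level⁻ : ∀ q {a b} → suc q * m + a < q * m + b → a + m < b
  next-level⁻ q {a} {b} h = +-cancelˡ-< (q * m) (a + m) b (subst (_< q * m + b) eq h)
    where
    eq : suc q * m + a ≡ q * m + (a + m)
    eq = trans (cong (_+ a) (+-comm m (q * m))) (trans (+-assoc (q * m) m a) (cong (q * m +_) (+-comm m a)))

  next-level′ : ∀ q {a b} → a + m < b → suc q * m + a < q * m + b
  next-level′ q {a} {b} h = subst (_< q * m + b) eq (+-monoʳ-< (q * m) h)
    where
    eq : q * m + (a + m) ≡ suc q * m + a
    eq = trans (cong (q * m +_) (+-comm a m)) (trans (sym (+-assoc (q * m) m a)) (cong (_+ a) (+-comm (q * m) m)))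

  levels : ∀ {q q′ a b} → q < q′ → a < b + m → q * m + a < q′ * m + b
  levels {q} {q′} {a} {b} q<q′ h = <-≤-trans (next-level q {a} {b} h) (+-monoˡ-≤ b (*-monoˡ-≤ m q<q′))

  S-mono : ∀ {i j} → i < j → S i < S j
  S-mono {i} {j} i<j with lex i<j
  ... | inj₁ (q , r) = subst (λ k → S i < k * m + L.s (at j)) q (+-monoʳ-< (quotient i * m) (nth-mono r))
  ... | inj₂ q = levels q (<-≤-trans (L.s<m _) (m≤n+m m _))

  E-mono : ∀ {i j} → i < j → E i < E j
  E-mono {i} {j} i<j with lex i<j
  ... | inj₁ (q , r) = subst (λ k → E i < k * m + L.e (at j)) q
    (+-monoʳ-< (quotient i * m) (Two.ends-increase (nth-inj r) (nth-mono r)))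
  ... | inj₂ q = levels q (e-wrap _ _)

  E<S : ∀ i → E i < S (i + n)
  E<S i = subst (E i <_) (trans (sym (+-assoc (quotient i * m) (L.s (at i)) m)) (sym (lift-per L.s i)))
    (+-monoʳ-< (quotient i * m) (L.e<s+m (at i)))

  module _ {i j : ℕ} (i<j : i < j) (j<i : j < i + n) where
    private
      K = quotient i * m
      u = at i
      v = at j
      S+n : S (i + n) ≡ suc (quotient i) * m + L.s u
      S+n = cong₂ (λ q r → q * m + L.s (nth r)) (quotient-per i) (residue-per i)

    adj⇒ : Adj G u v → S j < E i ⊎ S (i + n) < E j
    adj⇒ h with lex-window i<j j<i
    ... | inj₁ (q , r) with Two.meet⇒ (nth-inj r) (nth-mono r) (Equivalence.to (adj u v (nth-inj r)) h)
    ... | inj₁ k = inj₁ (subst (λ z → z * m + L.s v < E i) (sym q) (+-monoʳ-< K k))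
    ... | inj₂ k = inj₂ (subst₂ (λ z z′ → z < z′ * m + L.e v) (sym S+n) (sym q) (next-level′ (quotient i) k))
    adj⇒ h | inj₂ (q , r)
      with Two.meet⇒ (nth-inj r) (nth-mono r) (Equivalence.to (adj v u (nth-inj r)) (trans (Graph.sym G v u) h))
    ... | inj₁ k = inj₂ (subst₂ (λ z z′ → z < z′ * m + L.e v) (sym S+n) (sym q) (+-monoʳ-< (m + K) k))
    ... | inj₂ k = inj₁ (subst (λ z → z * m + L.s v < E i) (sym q) (next-level′ (quotient i) k))

    adj⇐ : S j < E i ⊎ S (i + n) < E j → Adj G u v
    adj⇐ h with lex-window i<j j<i
    adj⇐ (inj₁ h) | inj₁ (q , r) = Equivalence.from (adj u v (nth-inj r)) (Two.meet⇐ (nth-inj r) (nth-mono r)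
      (inj₁ (+-cancelˡ-< K _ _ (subst (λ z → z * m + L.s v < E i) q h))))
    adj⇐ (inj₂ h) | inj₁ (q , r) = Equivalence.from (adj u v (nth-inj r)) (Two.meet⇐ (nth-inj r) (nth-mono r)
      (inj₂ (next-level⁻ (quotient i) (subst₂ (λ z z′ → z < z′ * m + L.e v) S+n q h))))
    adj⇐ (inj₁ h) | inj₂ (q , r) = trans (Graph.sym G u v) (Equivalence.from (adj v u (nth-inj r)) (Two.meet⇐ (nth-inj r) (nth-mono r)
      (inj₂ (next-level⁻ (quotient i) (subst (λ z → z * m + L.s v < E i) q h)))))
    adj⇐ (inj₂ h) | inj₂ (q , r) = trans (Graph.sym G u v) (Equivalence.from (adj v u (nth-inj r)) (Two.meet⇐ (nth-inj r) (nth-mono r)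
      (inj₁ (+-cancelˡ-< (m + K) _ _ (subst₂ (λ z z′ → z < z′ * m + L.e v) S+n q h)))))

  at-inj : ∀ {i j} → i < j → j < i + n → at i ≢ at j
  at-inj i<j j<i with lex-window i<j j<i
  ... | inj₁ (q , r) = nth-inj r
  ... | inj₂ (q , r) = nth-inj r ∘ sym

  at-rank : ∀ u → at (toℕ (rank u)) ≡ u
  at-rank u = trans (cong nth (toℕ-injective (trans (toℕ-fromℕ< _) (m<n⇒m%n≡m (toℕ<n (rank u)))))) (nth-rank u)

  model : ArcModel G
  model = record
    { cycle = record { at = at ; at-per = λ i → cong nth (residue-per i) ; at-inj = at-inj
                     ; index = toℕ ∘ rank ; index< = λ u → toℕ<n (rank u) ; at-index = at-rank }
    ; m = m ; S = S ; E = E ; S-per = lift-per L.s ; E-per = lift-per L.e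
    ; S-mono = S-mono ; E-mono = E-mono ; S<E = λ i → +-monoʳ-< (quotient i * m) (L.s<e (at i)) ; E<S = E<S
    ; adj⇒ = adj⇒ ; adj⇐ = adj⇐ }

round-of-PCA : ∀ {n} {G : Graph n} → 2 ≤ n → TwinFree G → PCA G → Round G
round-of-PCA {suc zero} (s≤s ()) _ _
round-of-PCA {suc (suc n)} {G} 2≤n twin-free (m , A , arc , nonempty , adj , incomparable) =
  ArcModel.round (Model.model A L adj incomparable) 2≤n twin-free
  where
  other : (v : Fin (suc (suc n))) → ∃[ u ] u ≢ v
  other Fin.zero = Fin.suc Fin.zero , λ ()
  other (Fin.suc v) = Fin.zero , λ ()
  L : ∀ v → LiftedArc (A v)
  -- With a second vertex present no arc is the whole circle, since it would contain the arc of that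
  -- vertex.
  L v = liftArc (arc v) (nonempty v) λ full → incomparable (proj₁ (other v)) v (proj₂ (other v)) (λ p _ → full p)

-- Uniqueness when the complement is not bipartite

reach-closed : ∀ {n} {R : Fin n → Fin n → Set} (S : Fin n → Set) → (∀ {u v} → S u → R u v → S v) →
               ∀ {u v} → Reach R u v → S u → S v
reach-closed S closed here s = s
reach-closed S closed (step r p) s = reach-closed S closed p (closed s r)

coadj-not-near : ∀ {n} {G : Graph n} {u v} → CoAdj G u v → ¬ (N[ u ] G) v
coadj-not-near (u≢v , _) (inj₁ eq) = u≢v (sym eq)
coadj-not-near (_ , non) (inj₂ adj) = contradiction (trans (sym adj) non) λ ()

coadj-sym : ∀ {n} {G : Graph n} {u v} → CoAdj G u v → CoAdj G v u
coadj-sym {G = G} {u} {v} (u≢v , non) = u≢v ∘ sym , trans (Graph.sym G v u) non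

module RoundGraph {n : ℕ} {G : Graph n} (R : Round G) where
  open Round R
  open CycleOrder cycle

  close : ∀ {i j} → i ≤ j → j < x i → (N[ at i ] G) (at j)
  close {i} {j} i≤j j<x = subst (N[ at i ] G) (at-per j) (near (≤-trans (y≤ i) (+-monoˡ-≤ n i≤j)) (+-monoˡ-< n j<x))

  separating : 2 ≤ n → TwinFree G → Separating
  separating 2≤n twin-free a with x a <? x (suc a) | y a <? y (suc a)
  ... | yes h | _ = inj₁ h
  ... | no _ | yes h = inj₂ h
  ... | no h | no h′ = contradiction same (twin-free (at a) (at (suc a)) (at-inj (n<1+n a) (subst (2 + a ≤_) (+-comm n a) (+-monoˡ-≤ a 2≤n))))
    where
    x≡ : x (suc a) ≡ x a
    x≡ = ≤-antisym (≮⇒≥ h) (x-mono (n≤1+n a))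
    y≡ : y (suc a) ≡ y a
    y≡ = ≤-antisym (≮⇒≥ h′) (y-mono (n≤1+n a))
    same : ∀ w → (N[ at a ] G) w ⇔ (N[ at (suc a) ] G) w
    same w with index-from (x a) w
    ... | j , x≤j , j<x , refl with j <? y a
    ... | yes j<y = mk⇔ (λ k → contradiction k (far x≤j j<y))
      (λ k → contradiction k (far (subst (_≤ j) (sym x≡) x≤j) (subst (j <_) (sym y≡) j<y)))
    ... | no j≮y = mk⇔ (λ _ → near (subst (_≤ j) (sym y≡) (≮⇒≥ j≮y)) (subst (λ z → j < z + n) (sym x≡) j<x))
                       (λ _ → near (≮⇒≥ j≮y) j<x)

  -- If no edge passed over either gap, the vertices after `p` up to `q` would be closed under
  -- adjacency, while `suc q` is outside.
  linked : Connected (Adj G) → ∀ p q → p < q → q < p + n → suc p < x p ⊎ suc q < x q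
  linked conn p q p<q q<p with suc p <? x p | suc q <? x q
  ... | yes h | _ = inj₁ h
  ... | no _ | yes h = inj₂ h
  ... | no h | no h′ with reach-closed S closed (conn (at (suc p)) (at (suc q))) (suc p , n<1+n p , p<q , refl)
    where
    S : Fin n → Set
    S u = ∃[ i ] (p < i × i ≤ q × at i ≡ u)
    closed : ∀ {u v} → S u → Adj G u v → S v
    closed {u} {v} (i , p<i , i≤q , refl) adj with index-from (suc p) v
    ... | j , p<j , j<p , refl with j ≤? q
    ... | yes j≤q = j , p<j , j≤q , refl
    ... | no j≰q = contradiction (inj₂ adj) (far (≤-trans (x-mono i≤q) (≤-trans (≮⇒≥ h′) (≰⇒> j≰q)))
            (gal₄ (≤-trans (x-mono (s≤s⁻¹ j<p)) (≤-trans (x-per-≤ (≮⇒≥ h)) (+-monoˡ-≤ n p<i)))))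
  ... | i , p<i , i≤q , eq = contradiction eq (at-inj (s≤s i≤q) (≤-<-trans q<p (+-monoˡ-< n p<i)))

  module TwoCliques (a : ℕ) (a≤xxa : a + n ≤ x (x a)) where

    first : Fin n → Bool
    first u = proj₁ (index-from a u) <ᵇ x a

    together : ∀ {i j} → a ≤ i → i < j → j < a + n → (i <ᵇ x a) ≡ (j <ᵇ x a) → (N[ at i ] G) (at j)
    together {i} {j} a≤i i<j j<a eq with i <? x a | j <? x a
    ... | _ | yes j<x = close (<⇒≤ i<j) (<-≤-trans j<x (x-mono a≤i))
    ... | yes i<x | no j≮x = contradiction (trans (sym (<ᵇ-true i<x)) (trans eq (<ᵇ-false (≮⇒≥ j≮x)))) λ ()
    ... | no i≮x | no j≮x = close (<⇒≤ i<j) (<-≤-trans j<a (≤-trans a≤xxa (x-mono (≮⇒≥ i≮x))))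

    bipartite : Bipartite (CoAdj G)
    bipartite = first , proper
      where
      proper : ∀ u v → CoAdj G u v → first u ≢ first v
      proper u v co eq with index-from a u | index-from a v
      ... | i , a≤i , i<a , refl | j , a≤j , j<a , refl with <-cmp i j
      ... | tri< i<j _ _ = coadj-not-near {G = G} co (together a≤i i<j j<a eq)
      ... | tri≈ _ refl _ = proj₁ co refl
      ... | tri> _ _ j<i = coadj-not-near {G = G} (coadj-sym {G = G} co) (together a≤j j<i i<a (sym eq))

  non-bipartite : ¬ Bipartite (CoAdj G) → ∀ a → x (x a) < a + n
  non-bipartite ¬bip a = ≰⇒> (λ h → ¬bip (TwoCliques.bipartite a h))

  -- The three cases are the positions of `[x i, y i)` relative to the cut of the circle at `n`:
  -- before it, after it, or across it. In the last case the closed neighbourhood itself is an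
  -- interval of the listing.
  round-arc : ∀ i → i < n → IsArc n (posSet order (N[ at i ] G))
  round-arc i i<n with y i ≤? n | n ≤? x i
  ... | yes y≤n | _ = x i , y i , x≤y i , y≤n , inj₂ λ p → mk⇔ (λ h k → far (proj₁ k) (proj₂ k) h) (inside p)
    where
    inside : ∀ p → ¬ InInterval (x i) (y i) p → (N[ at i ] G) (at (toℕ p))
    inside p out with x i ≤? toℕ p
    ... | yes h = near (≮⇒≥ (λ k → out (h , k))) (<-≤-trans (toℕ<n p) (m≤n+m n (x i)))
    ... | no h = subst (N[ at i ] G) (at-per (toℕ p)) (near (≤-trans y≤n (m≤n+m n (toℕ p))) (+-monoˡ-< n (≰⇒> h)))
  ... | no _ | yes n≤x = x′ , y′ , +-cancelʳ-≤ n x′ y′ (subst₂ _≤_ (sym x≡) (sym y≡) (x≤y i))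
      , ≤-trans y′≤i (<⇒≤ i<n) , inj₂ λ p → mk⇔ (outside p) (inside p)
    where
    x′ = x i ∸ n
    y′ = y i ∸ n
    x≡ : x′ + n ≡ x i
    x≡ = m∸n+n≡m n≤x
    y≡ : y′ + n ≡ y i
    y≡ = m∸n+n≡m (≤-trans n≤x (x≤y i))
    y′≤i : y′ ≤ i
    y′≤i = +-cancelʳ-≤ n y′ i (subst (_≤ i + n) (sym y≡) (y≤ i))
    outside : ∀ p → (N[ at i ] G) (at (toℕ p)) → ¬ InInterval x′ y′ p
    outside p h (x≤p , p<y) = far (subst (_≤ toℕ p + n) x≡ (+-monoˡ-≤ n x≤p)) (subst (toℕ p + n <_) y≡ (+-monoˡ-< n p<y))
      (subst (N[ at i ] G) (sym (at-per (toℕ p))) h)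
    inside : ∀ p → ¬ InInterval x′ y′ p → (N[ at i ] G) (at (toℕ p))
    inside p out with x′ ≤? toℕ p
    ... | yes h = subst (N[ at i ] G) (at-per (toℕ p))
      (near (subst (_≤ toℕ p + n) y≡ (+-monoˡ-≤ n (≮⇒≥ (λ k → out (h , k)))))
            (+-monoˡ-< n (<-≤-trans (toℕ<n p) n≤x)))
    ... | no h = subst (N[ at i ] G) (trans (at-per (toℕ p + n)) (at-per (toℕ p)))
      (near (≤-trans (≤-reflexive (sym y≡)) (+-monoˡ-≤ n (≤-trans y′≤i (≤-trans (<⇒≤ i<n) (m≤n+m n (toℕ p))))))
            (+-monoˡ-< n (subst (toℕ p + n <_) x≡ (+-monoˡ-< n (≰⇒> h)))))
  ... | no y≰n | no n≰x = y′ , x i , y′≤x , <⇒≤ (≰⇒> n≰x) , inj₁ λ p → mk⇔ (inside p) (outside p)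
    where
    y′ = y i ∸ n
    y≡ : y′ + n ≡ y i
    y≡ = m∸n+n≡m (≰⇒≥ y≰n)
    y′≤x : y′ ≤ x i
    y′≤x = +-cancelʳ-≤ n y′ (x i) (subst (_≤ x i + n) (sym y≡) (≤-trans (y≤ i) (+-monoˡ-≤ n (<⇒≤ (i<x i)))))
    inside : ∀ p → (N[ at i ] G) (at (toℕ p)) → InInterval y′ (x i) p
    inside p h = ≮⇒≥ (λ k → far (≤-trans (≰⇒≥ n≰x) (m≤n+m n (toℕ p))) (subst (toℕ p + n <_) y≡ (+-monoˡ-< n k))
                                 (subst (N[ at i ] G) (sym (at-per (toℕ p))) h))
               , ≰⇒> (λ k → far k (<-trans (toℕ<n p) (≰⇒> y≰n)) h)
    outside : ∀ p → InInterval y′ (x i) p → (N[ at i ] G) (at (toℕ p))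
    outside p (y≤p , p<x) = subst (N[ at i ] G) (at-per (toℕ p))
      (near (subst (_≤ toℕ p + n) y≡ (+-monoˡ-≤ n y≤p)) (+-monoˡ-< n p<x))

  order-arc : ArcOrdering G order
  order-arc v = subst (λ u → IsArc n (posSet order (N[ u ] G))) (at-index v) (round-arc (index v) (index< v))

  non-bipartite-case : TwinFree G → Connected (Adj G) → ¬ Bipartite (CoAdj G) →
    ∃[ σ ] (ArcOrdering G σ × (∀ τ → ArcOrdering G τ → SameUpToReversal σ τ))
  non-bipartite-case twin-free conn ¬bip = order , order-arc , unique
    where
    nb = non-bipartite ¬bip
    3≤n : 3 ≤ n
    3≤n = ≤-trans (s≤s (≤-trans (s≤s (i<x 0)) (i<x (x 0)))) (nb 0)
    2≤n = ≤-trans (n≤1+n 2) 3≤n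
    unique : ∀ τ → ArcOrdering G τ → SameUpToReversal order τ
    unique τ arc = same-order 3≤n τ λ a → pair-next a 2≤n
      (AllPairs.pair dial family (convex-E arc) nb (separating 2≤n twin-free) (linked conn) a)
      where open Ordered R τ

-- Co-bipartite graphs as two cliques on complementary intervals

-- Allows the boundary between the two cliques to be placed at position 0.
rotate : ∀ {n} {G : Graph n} → Round G → ℕ → Round G
rotate {n} {G} R a = record
  { cycle = record
    { at = λ i → at (i + a)
    ; at-per = λ i → trans (cong at (exchange i)) (at-per (i + a))
    ; at-inj = λ {i} {j} i<j j<i → at-inj (+-monoˡ-< a i<j) (subst (j + a <_) (exchange i) (+-monoˡ-< a j<i))
    ; index = λ u → proj₁ (index-from a u) ∸ a
    ; index< = λ u → +-cancelʳ-< a _ _ (subst₂ _<_ (sym (index≡ u)) (+-comm a n) (proj₁ (proj₂ (proj₂ (index-from a u)))))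
    ; at-index = λ u → trans (cong at (index≡ u)) (proj₂ (proj₂ (proj₂ (index-from a u))))
    }
  ; dial = record
    { x = X ; y = Y
    ; x-mono = λ i≤j → ∸-monoˡ-≤ a (x-mono (+-monoˡ-≤ a i≤j))
    ; x-per = λ i → +-cancelʳ-≡ a _ _ (begin
        X (i + n) + a     ≡⟨ X≡ (i + n) ⟩
        x (i + n + a)     ≡⟨ cong x (exchange i) ⟩
        x (i + a + n)     ≡⟨ x-per (i + a) ⟩
        x (i + a) + n     ≡⟨ cong (_+ n) (X≡ i) ⟨
        X i + a + n       ≡⟨ exchange (X i) ⟨
        X i + n + a       ∎)
    ; i<x = λ i → +-cancelʳ-< a _ _ (subst (i + a <_) (sym (X≡ i)) (i<x (i + a)))
    ; x≤y = λ i → ∸-monoˡ-≤ a (x≤y (i + a))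
    ; gal₁ = λ {u} {k} h → +-cancelʳ-< a _ _ (subst₂ _<_ (sym (exchange u)) (sym (X≡ k))
        (gal₁ (subst (_≤ k + a) (Y≡ u) (+-monoˡ-≤ a h))))
    ; gal₂ = λ {u} {k} h → +-cancelʳ-≤ a _ _ (subst (_≤ k + a) (sym (Y≡ u))
        (gal₂ (subst₂ _<_ (exchange u) (X≡ k) (+-monoˡ-< a h))))
    }
  ; far = λ {i} {j} x≤j j<y → far (subst (_≤ j + a) (X≡ i) (+-monoˡ-≤ a x≤j)) (subst (j + a <_) (Y≡ i) (+-monoˡ-< a j<y))
  ; near = λ {i} {j} y≤j j<x → near (subst (_≤ j + a) (Y≡ i) (+-monoˡ-≤ a y≤j))
      (subst (j + a <_) (trans (exchange (X i)) (cong (_+ n) (X≡ i))) (+-monoˡ-< a j<x))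
  }
  where
  open Round R
  open ≡-Reasoning
  exchange : ∀ i → i + n + a ≡ i + a + n
  exchange i = trans (+-assoc i n a) (trans (cong (i +_) (+-comm n a)) (sym (+-assoc i a n)))
  X Y : ℕ → ℕ
  X i = x (i + a) ∸ a
  Y i = y (i + a) ∸ a
  X≡ : ∀ i → X i + a ≡ x (i + a)
  X≡ i = m∸n+n≡m (≤-trans (m≤n+m a i) (<⇒≤ (i<x (i + a))))
  Y≡ : ∀ i → Y i + a ≡ y (i + a)
  Y≡ i = m∸n+n≡m (≤-trans (m≤n+m a i) (<⇒≤ (i<y (i + a))))
  index≡ : ∀ u → proj₁ (index-from a u) ∸ a + a ≡ proj₁ (index-from a u)
  index≡ u = m∸n+n≡m (proj₁ (proj₂ (index-from a u)))

module CoGraph {n : ℕ} {G : Graph n} (R : Round G) where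
  open Round R

  far-coadj : ∀ {i j} → x i ≤ j → j < y i → CoAdj G (at i) (at j)
  far-coadj {i} {j} x≤j j<y = (λ eq → far x≤j j<y (inj₁ (sym eq))) , non (adj G (at i) (at j)) refl
    where
    non : ∀ b → adj G (at i) (at j) ≡ b → adj G (at i) (at j) ≡ false
    non false eq = eq
    non true eq = contradiction (inj₂ eq) (far x≤j j<y)

  coadj-far : ∀ {i v} → CoAdj G (at i) v → ∃[ j ] (x i ≤ j × j < y i × at j ≡ v)
  coadj-far {i} {v} co with index-from (x i) v
  ... | j , x≤j , j<x , refl with j <? y i
  ... | yes j<y = j , x≤j , j<y , refl
  ... | no j≮y = contradiction (near (≮⇒≥ j≮y) j<x) (coadj-not-near {G = G} co)

  -- A vertex with no co-neighbour would be isolated in the complement.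
  nonempty : 2 ≤ n → Connected (CoAdj G) → ∀ i → x i < y i
  nonempty 2≤n coconn i with coconn (at i) (at (suc i)) | at-inj (n<1+n i) (subst (2 + i ≤_) (+-comm n i) (+-monoˡ-≤ i 2≤n))
  ... | p | distinct = go p distinct
    where
    go : ∀ {v} → Reach (CoAdj G) (at i) v → at i ≢ v → x i < y i
    go here i≢v = contradiction refl i≢v
    go (step co _) _ with coadj-far co
    ... | j , x≤j , j<y , _ = ≤-<-trans x≤j j<y

-- The positions 0, …, k - 1 and k, …, n - 1 carry two cliques covering the graph.
record TwoSided {n : ℕ} (G : Graph n) : Set where
  field
    R : Round G
    k : ℕ
  open Round R public
  field
    x0 : x 0 ≡ k
    xk : x k ≡ n
    2≤n : 2 ≤ n
    twin-free : TwinFree G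
    conn : Connected (Adj G)
    coconn : Connected (CoAdj G)

  open RoundGraph R using (linked; separating)
  open CoGraph R

  sep : Separating
  sep = separating 2≤n twin-free

  x<y : ∀ i → x i < y i
  x<y = nonempty 2≤n coconn

  0<k : 0 < k
  0<k = subst (0 <_) x0 (i<x 0)

  k<n : k < n
  k<n = subst (_< n) x0 (<-≤-trans (x<y 0) (y≤ 0))

  first≥ : ∀ w → k ≤ x w
  first≥ w = subst (_≤ x w) x0 (x-mono z≤n)

  first≤ : ∀ {w} → w < k → y w ≤ n
  first≤ w<k = gal₂ (<-≤-trans (+-monoˡ-< n w<k) (subst (λ z → z + n ≤ x n) x0 (x-per-≥ ≤-refl)))

  second≥ : ∀ {w} → k ≤ w → n ≤ x w
  second≥ {w} k≤w = subst (_≤ x w) xk (x-mono k≤w)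

  second≤ : ∀ {w} → w < n → y w ≤ k + n
  second≤ w<n = gal₂ (<-≤-trans (+-monoˡ-< n w<n) (x-per-≥ (≤-reflexive (sym xk))))

  -- Otherwise the positions up to `w`, together with those from `k` to `y w - 1`, would be closed
  -- under co-adjacency and miss `suc w`, against connectedness of the complement.
  overlapping : ∀ {w} → suc w < k → x (suc w) < y w
  overlapping {w} sw<k = ≰⇒> λ y≤x → impossible y≤x (reach-closed S (closed y≤x) (coconn (at 0) (at (suc w))) (0 , inj₁ z≤n , refl))
    where
    S : Fin n → Set
    S u = ∃[ i ] ((i ≤ w ⊎ (k ≤ i × i < y w)) × at i ≡ u)
    closed : y w ≤ x (suc w) → ∀ {u v} → S u → CoAdj G u v → S v
    closed y≤x (i , inj₁ i≤w , refl) co with coadj-far co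
    ... | j , x≤j , j<y , eq = j , inj₂ (≤-trans (first≥ i) x≤j , <-≤-trans j<y (y-mono i≤w)) , eq
    closed y≤x (i , inj₂ (k≤i , i<y) , refl) co with coadj-far co
    ... | j , x≤j , j<y , eq with lower-index {0} (≤-trans (second≥ k≤i) x≤j)
    ... | l , _ , refl = l , inj₁ (≮⇒≥ λ w<l → <⇒≱ i<y (≤-trans y≤x (≤-trans (x-mono w<l)
            (+-cancelʳ-≤ n _ _ (subst (_≤ i + n) (x-per l) (gal₃ j<y)))))) , trans (sym (at-per l)) eq
    impossible : y w ≤ x (suc w) → ¬ S (at (suc w))
    impossible y≤x (i , inj₁ i≤w , eq) = at-inj (s≤s i≤w) (<-≤-trans (<-trans sw<k k<n) (m≤n+m n i)) eq
    impossible y≤x (i , inj₂ (k≤i , i<y) , eq) = at-inj (<-≤-trans sw<k k≤i)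
      (<-≤-trans i<y (≤-trans (first≤ (<-trans (n<1+n w) sw<k)) (m≤n+m n (suc w)))) (sym eq)

  -- The co-neighbourhood of position `n - 1` is nonempty and ends by `k + n`, so it starts at
  -- `w + n` or earlier; duality turns this into a bound on `y w`.
  last-reaches : ∀ {w} → suc w ≡ k → n ≤ y w
  last-reaches {w} sw≡k = go n refl
    where
    go : ∀ m → m ≡ n → m ≤ y w
    go zero _ = z≤n
    go (suc m) eq = gal₄ (s≤s⁻¹ (subst (λ l → x m < l + n) (sym sw≡k) (<-≤-trans (x<y m) (second≤ (≤-reflexive eq)))))

  -- Walk down from the last vertex of the first side. Overlap of consecutive co-neighbourhoods
  -- prevents the walk from jumping over the gap at `p`.
  common : ∀ {p} → k < p → p < n → ∃[ w ] (w < k × x w < p × p < y w)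
  common {p} k<p p<n = start k refl
    where
    search : ∀ w → w < k → p < y w → ∃[ w ] (w < k × x w < p × p < y w)
    search w w<k p<y with x w <? p
    ... | yes h = w , w<k , h , p<y
    search zero w<k p<y | no h = contradiction (subst (_< p) (sym x0) k<p) h
    search (suc w) w<k p<y | no h = search w (<-trans (n<1+n w) w<k) (≤-<-trans (≮⇒≥ h) (overlapping w<k))
    start : ∀ l → l ≡ k → ∃[ w ] (w < k × x w < p × p < y w)
    start zero eq = contradiction eq (<⇒≢ 0<k)
    start (suc l) eq = search l (≤-reflexive eq) (<-≤-trans p<n (last-reaches eq))

  private
    Cut : ℕ → Set
    Cut g = ∃[ u ] (u < k × (x u ≡ g ⊎ y u ≡ g))

  -- Chords of second-side vertices end in the first side, so the chord found by `cut` belongs to a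
  -- first-side vertex, up to a turn.
  cut-inside : ∀ {g} → k ≤ g → suc g < n → Cut (suc g)
  cut-inside {g} k≤g g<n =
    [ (λ (u , eq) → locate u (≤-reflexive eq) (≤-trans (≤-reflexive (sym eq)) (x≤y u)) (inj₁ eq))
    , (λ (u , eq) → locate u (≤-trans (x≤y u) (≤-reflexive eq)) (≤-reflexive (sym eq)) (inj₂ eq)) ]′ (cut sep g)
    where
    locate : ∀ u → x u ≤ suc g + n → suc g + n ≤ y u → x u ≡ suc g + n ⊎ y u ≡ suc g + n → Cut (suc g)
    locate u x≤ ≤y eq with u <? n | u <? k + n
    ... | yes u<n | _ = contradiction (second≤ u<n) (<⇒≱ (<-≤-trans (+-monoˡ-< n (s≤s k≤g)) ≤y))
    ... | no _ | no u≮ = contradiction (≤-trans (x-per-≥ (≤-reflexive (sym xk))) (≤-trans (x-mono (≮⇒≥ u≮)) x≤)) (<⇒≱ (+-monoˡ-< n g<n))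
    ... | no u≮n | yes u< with lower-index {0} (≮⇒≥ u≮n)
    ... | l , _ , refl = l , +-cancelʳ-< n l k u<
      , map (λ e → +-cancelʳ-≡ n _ _ (trans (sym (x-per l)) e)) (λ e → +-cancelʳ-≡ n _ _ (trans (sym (y-per l)) e)) eq

  -- If the first side were a single vertex, connectedness would give a second side with at least
  -- two, and positions 1 and 2 would be twins whose only co-neighbour is that vertex.
  2≤k : 2 ≤ k
  2≤k = ≰⇒> λ k≤1 → single (≤-antisym k≤1 0<k)
    where
    single : k ≡ 1 → ⊥
    single k≡1 with linked conn 0 1 (n<1+n 0) (subst (_< n) k≡1 k<n)
    ... | inj₁ h = contradiction (trans x0 k≡1) (>⇒≢ h)
    ... | inj₂ h with subst (2 <_) (trans (cong x (sym k≡1)) xk) h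
    ... | 2<n = [ (λ h′ → <⇒≱ (<-≤-trans h′ (s≤s⁻¹ (<-≤-trans (x<y 2) (y≤1+n 2<n)))) n≤x1)
                , (λ h′ → <⇒≱ (<-≤-trans h′ (y≤1+n 2<n)) (≤-<-trans n≤x1 (x<y 1))) ]′ (sep 1)
      where
      n≤x1 : n ≤ x 1
      n≤x1 = second≥ (≤-reflexive k≡1)
      y≤1+n : 2 < n → y 2 ≤ 1 + n
      y≤1+n 2<n = subst (λ l → y 2 ≤ l + n) k≡1 (second≤ 2<n)

module _ {n : ℕ} {G : Graph n} (2≤n : 2 ≤ n) (twin-free : TwinFree G)
    (conn : Connected (Adj G)) (coconn : Connected (CoAdj G)) where

  -- Consecutive positions of different colours have no common co-neighbour, in particular not
  -- `x (suc a)`; by duality this closes the turn.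
  bicoloured-turn : (R : Round G) → Bipartite (CoAdj G) → let open Round R in ∃[ a ] a + n ≤ x (x a)
  bicoloured-turn R (c , proper) = [ found , (λ same → contradiction same not-constant) ]′ (search n)
    where
    open Round R
    open CoGraph R
    Turn : ℕ → Set
    Turn a = c (at a) ≢ c (at (suc a))
    search : ∀ m → (∃[ a ] Turn a) ⊎ (∀ {i} → i ≤ m → c (at i) ≡ c (at 0))
    search zero = inj₂ λ { z≤n → refl }
    search (suc m) with search m | c (at m) ≟ᵇ c (at (suc m))
    ... | inj₁ t | _ = inj₁ t
    ... | inj₂ _ | no ne = inj₁ (m , ne)
    ... | inj₂ same | yes eq = inj₂ λ {i} i≤ → [ (λ h → same (s≤s⁻¹ h)) , (λ { refl → trans (sym eq) (same ≤-refl) }) ]′ (m≤n⇒m<n∨m≡n i≤)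
    not-constant : ¬ (∀ {i} → i ≤ n → c (at i) ≡ c (at 0))
    not-constant same = proper (at 0) (at (x 0)) (far-coadj ≤-refl (nonempty 2≤n coconn 0)) (sym (same (x≤ 0)))
    two-values : ∀ {a b d : Bool} → a ≢ d → b ≢ d → a ≡ b
    two-values {false} {false} _ _ = refl
    two-values {true} {true} _ _ = refl
    two-values {false} {true} {false} h _ = contradiction refl h
    two-values {false} {true} {true} _ h = contradiction refl h
    two-values {true} {false} {true} h _ = contradiction refl h
    two-values {true} {false} {false} _ h = contradiction refl h
    found : ∃[ a ] Turn a → ∃[ a ] a + n ≤ x (x a)
    found (a , turn) = suc a , gal₁ (≮⇒≥ λ w<y → turn (two-values
      (proper _ _ (far-coadj (x-mono (n≤1+n a)) w<y))
      (proper _ _ (far-coadj ≤-refl (<-≤-trans w<y (y-mono (n≤1+n a)))))))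

  twoSided : Round G → Bipartite (CoAdj G) → TwoSided G
  twoSided R bip with bicoloured-turn R bip
  ... | a , turn = record
    { R = rotate R a ; k = x′ 0 ; x0 = refl
    ; xk = ≤-antisym (gal₃′ (CoGraph.nonempty (rotate R a) 2≤n coconn 0))
        (+-cancelʳ-≤ a _ _ (subst₂ _≤_ (+-comm a n) (sym full) turn))
    ; 2≤n = 2≤n ; twin-free = twin-free ; conn = conn ; coconn = coconn }
    where
    open Round R
    open Round (rotate R a) using () renaming (x to x′; gal₃ to gal₃′)
    full : x′ (x′ 0) + a ≡ x (x a)
    full = trans (m∸n+n≡m (≤-trans (m≤n+m a (x′ 0)) (<⇒≤ (i<x _)))) (cong x (m∸n+n≡m (<⇒≤ (i<x a))))

exchange-sides : ∀ {n} {G : Graph n} → TwoSided G → TwoSided G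
exchange-sides {n} T = record
  { R = rotate R k ; k = n ∸ k ; x0 = cong (_∸ k) xk
  ; xk = trans (cong (λ i → x i ∸ k) (m∸n+n≡m (<⇒≤ k<n))) (trans (cong (_∸ k) xn) (m+n∸m≡n k n))
  ; 2≤n = 2≤n ; twin-free = twin-free ; conn = conn ; coconn = coconn }
  where
  open TwoSided T
  xn : x n ≡ k + n
  xn = trans (x-per 0) (cong (_+ n) x0)

-- Tight orderings on one side

module TightOrder {n : ℕ} {G : Graph n} (T : TwoSided G) (τ : CircOrd n) (tight : TightArcOrdering G τ) where
  open TwoSided T
  open Ordered R τ
  open Chords family

  E : ∀ w → Convex (x w) (y w)
  E = convex-E (proj₁ tight)

  y<x+n : ∀ {w} → w < k → y w < x w + n
  y<x+n {w} w<k = ≤-<-trans (first≤ w<k) (m<n+m n (≤-<-trans z≤n (i<x w)))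

  module Nested {w u : ℕ} (u<k : u < k) (x≤x : x w ≤ x u) (y≤y : y u ≤ y w) where
    private
      Nw = N[ at w ] G
      Nu = N[ at u ] G

      Nw⊆Nu : ∀ v → Nw v → Nu v
      Nw⊆Nu v h with index-from (x u) v
      ... | j , x≤j , j<x , refl with j <? y u
      ... | yes j<y = contradiction h (far (≤-trans x≤x x≤j) (<-≤-trans j<y y≤y))
      ... | no j≮y = near (≮⇒≥ j≮y) j<x

    Link : Set
    Link = ∃[ r ] ∃[ s ] (y w ≤ r × r < x w + n × x u ≤ s × s < y u ×
      (Follow τ (at r) (at s) ⊎ Follow τ (at s) (at r)))

    -- An endpoint shared by the nested neighbourhoods is a member of the smaller one that is next,
    -- in τ, to a non-member of the larger one.
    link : Link
    link with proj₂ tight (at w) (at u) Nw⊆Nu (λ all → far ≤-refl (x<y u) (all _))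
    ... | p , (inw , _) , (_ , outside) with index-from (x w) (Inverse.from τ p)
    ... | r , x≤r , r<x , eq = find outside
      where
      y≤r : y w ≤ r
      y≤r = ≮⇒≥ λ r<y → far x≤r r<y (subst Nw (sym eq) inw)
      to-r : Inverse.to τ (at r) ≡ p
      to-r = trans (cong (Inverse.to τ) eq) (Inverse.strictlyInverseˡ τ p)
      neighbour : ∀ q → ¬ posSet τ Nu q → Next p q ⊎ Next q p → Link
      neighbour q out next with index-from (x u) (Inverse.from τ q)
      ... | s , x≤s , s<x , eq′ = r , s , y≤r , r<x , x≤s
        , ≰⇒> (λ y≤s → out (subst Nu eq′ (near y≤s s<x)))
        , subst₂ (λ a b → Next a b ⊎ Next b a) (sym to-r) (sym to-s) next
        where
        to-s : Inverse.to τ (at s) ≡ q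
        to-s = trans (cong (Inverse.to τ) eq′) (Inverse.strictlyInverseˡ τ q)
      find : ¬ posSet τ Nu (predC p) ⊎ ¬ posSet τ Nu (sucC p) → Link
      find (inj₁ out) = neighbour (predC p) out (inj₂ (next-of-predC p))
      find (inj₂ out) = neighbour (sucC p) out (inj₁ (next-of-sucC p))

  -- The two chords share an end and do not cross, so `cap` gives nothing; the link obtained from
  -- tightness replaces the crossing.
  difference-left : ∀ {w u} → w < k → u < k → x w < x u → y u ≡ y w → Convex (x w) (x u)
  difference-left {w} {u} w<k u<k x<x y≡ with Nested.link u<k (<⇒≤ x<x) (≤-reflexive y≡)
  ... | r , s , y≤r , r<x , x≤s , s<y , l =
    convex-diff-right l x<x (subst (x u <_) y≡ (x<y u)) (y<x+n w<k) (E w) (subst (Convex (x u)) y≡ (E u))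
      y≤r r<x x≤s (subst (s <_) y≡ s<y)

  difference-right : ∀ {w u} → w < k → u < k → x u ≡ x w → y u < y w → Convex (y u) (y w)
  difference-right {w} {u} w<k u<k x≡ y<y with Nested.link {w} u<k (≤-reflexive (sym x≡)) (<⇒≤ y<y)
  ... | r , s , y≤r , r<x , x≤s , s<y , l =
    convex-diff-left l (subst (_< y u) x≡ (x<y u)) y<y (y<x+n w<k) (E w) (subst (λ z → Convex z (y u)) x≡ (E u))
      y≤r r<x (subst (_≤ s) x≡ x≤s) s<y

  -- A crossing with both ends kept in `[k, n]`, needed so that a chord across a piece of the side
  -- is again an arc of that side.
  Inner : ℕ → ℕ → Set
  Inner p q = (∃[ c ] ∃[ d ] (p < c × c < q × q < d × d ≤ n × Convex c d))
            ⊎ (∃[ c ] ∃[ d ] (k ≤ c × c < p × p < d × d < q × Convex c d))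

  -- The whole side is left out, as no chord with both ends in `[k, n]` crosses it.
  Proper : ℕ → ℕ → Set
  Proper p q = k ≤ p × q ≤ n × (k < p ⊎ q < n)

  -- A chord passing over the gap at `p` either ends inside `[p, q)` or spans it. In the spanning
  -- case the chord with an end at `suc p` crosses, unless both chords end at `q`; then their
  -- difference crosses.
  inner-left : ∀ {p q} → k < p → q ≤ n → suc p < q → Inner p q
  inner-left {p} {q} k<p q≤n sp<q with common k<p (<-≤-trans (<-trans (n<1+n p) sp<q) q≤n)
  ... | w , w<k , xw<p , p<yw with y w <? q
  ... | yes yw<q = inj₂ (x w , y w , first≥ w , xw<p , p<yw , yw<q , E w)
  ... | no yw≮q with cut-inside (<⇒≤ k<p) (<-≤-trans sp<q q≤n)
  ... | u , u<k , inj₂ yu≡ = inj₂ (x u , suc p , first≥ u , x<p , n<1+n p , sp<q , subst (Convex (x u)) yu≡ (E u))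
    where
    x<p : x u < p
    x<p = ≤-<-trans (x-mono (<⇒≤ (y-reflect (subst (_< y w) (sym yu≡) (<-≤-trans sp<q (≮⇒≥ yw≮q)))))) xw<p
  ... | u , u<k , inj₁ xu≡ with q <? y u
  ... | yes q<yu = inj₁ (suc p , y u , n<1+n p , sp<q , q<yu , first≤ u<k , subst (λ z → Convex z (y u)) xu≡ (E u))
  ... | no q≮yu = inj₂ (x w , suc p , first≥ w , xw<p , n<1+n p , sp<q
                       , subst (Convex (x w)) xu≡ (difference-left w<k u<k xw<xu yu≡yw))
    where
    xw<xu : x w < x u
    xw<xu = subst (x w <_) (sym xu≡) (<-trans xw<p (n<1+n p))
    yu≡yw : y u ≡ y w
    yu≡yw = ≤-antisym (≤-trans (≮⇒≥ q≮yu) (≮⇒≥ yw≮q)) (y-mono (<⇒≤ (x-reflect xw<xu)))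

  inner-right : ∀ {p q} → k ≤ p → suc q < n → p < q → Inner p (suc q)
  inner-right {p} {q} k≤p q<n p<q with common (s≤s (≤-trans k≤p (<⇒≤ p<q))) q<n
  ... | w , w<k , xw<q , q<yw with p <? x w
  ... | yes p<xw = inj₁ (x w , y w , p<xw , xw<q , q<yw , first≤ w<k , E w)
  ... | no p≮xw = split q refl
    where
    split : ∀ g → g ≡ q → Inner p (suc q)
    split zero refl = contradiction p<q λ ()
    split (suc g) refl with cut-inside (≤-trans k≤p (s≤s⁻¹ p<q)) (<-trans (n<1+n _) q<n)
    ... | u , u<k , inj₁ xu≡ = inj₁ (q , y u , p<q , n<1+n q , q<y , first≤ u<k , subst (λ z → Convex z (y u)) xu≡ (E u))
      where
      q<y : suc q < y u
      q<y = <-≤-trans q<yw (y-mono (<⇒≤ (x-reflect (subst (x w <_) (sym xu≡) (≤-<-trans (≮⇒≥ p≮xw) p<q)))))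
    ... | u , u<k , inj₂ yu≡ with x u <? p
    ... | yes xu<p = inj₂ (x u , q , first≥ u , xu<p , p<q , n<1+n q , subst (Convex (x u)) yu≡ (E u))
    ... | no xu≮p = inj₁ (q , y w , p<q , n<1+n q , q<yw , first≤ w<k
                         , subst (λ z → Convex z (y w)) yu≡ (difference-right w<k u<k xu≡xw yu<yw))
      where
      yu<yw : y u < y w
      yu<yw = subst (_< y w) (sym yu≡) (<-trans (n<1+n q) q<yw)
      xu≡xw : x u ≡ x w
      xu≡xw = ≤-antisym (x-mono (<⇒≤ (y-reflect yu<yw))) (≤-trans (≮⇒≥ p≮xw) (≮⇒≥ xu≮p))

  inner : ∀ {p q} → Proper p q → suc p < q → Inner p q
  inner (k≤p , q≤n , inj₁ k<p) sp<q = inner-left k<p q≤n sp<q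
  inner {p} {suc q} (k≤p , q≤n , inj₂ q<n) sp<q = inner-right k≤p q<n (s≤s⁻¹ sp<q)

  inner-crossed : ∀ {p q} → Proper p q → suc p < q → Crossed n Convex p q
  inner-crossed {p} {q} pr sp<q with inner pr sp<q
  ... | inj₁ (c , d , p<c , c<q , q<d , d≤n , g) =
    c , d , p<c , c<q , q<d , ≤-<-trans d≤n (m<n+m n (<-≤-trans 0<k (proj₁ pr))) , g
  ... | inj₂ (c , d , k≤c , c<p , p<d , d<q , g) =
    d , c + n , p<d , d<q , q<c+n , +-monoˡ-< n c<p , convex-compl (<-trans c<p p<d) (<-trans d<q q<c+n) g
    where
    q<c+n : q < c + n
    q<c+n = ≤-<-trans (proj₁ (proj₂ pr)) (m<n+m n (<-≤-trans 0<k k≤c))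

  shrink : ∀ {p q p′ q′} → p ≤ p′ → q′ ≤ q → Proper p q → Proper p′ q′
  shrink p≤ q≤ (k≤p , q≤n , s) = ≤-trans k≤p p≤ , ≤-trans q≤ q≤n
    , map (λ h → <-≤-trans h p≤) (λ h → ≤-<-trans q≤ h) s

  trim : ∀ {p q} a → Proper p q → p ≤ a → suc a < q → Convex p q → Convex a (2 + a)
  trim {p} {q} a = Trim.trim family Proper shrink inner-crossed q a (m≤m+n q p)

  inner-pair : ∀ a → k ≤ a → suc a < n → Convex a (2 + a)
  inner-pair a k≤a sa<n with common (s≤s k≤a) sa<n
  ... | w , w<k , xw<a , a<yw with k <? x w | y w <? n
  ... | yes k<x | _ = trim a (first≥ w , first≤ w<k , inj₁ k<x) (s≤s⁻¹ xw<a) a<yw (E w)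
  ... | no _ | yes y<n = trim a (first≥ w , first≤ w<k , inj₂ y<n) (s≤s⁻¹ xw<a) a<yw (E w)
  -- The chord is the whole side, to which `trim` does not apply. Unless the side is just the pair,
  -- cutting it at `suc a` leaves a half of at least two vertices, and a chord crossing that half is
  -- a proper arc around the pair.
  ... | no k≮x | no y≮n = finish (cut-inside k≤a sa<n)
    where
    xw≡ : x w ≡ k
    xw≡ = ≤-antisym (≮⇒≥ k≮x) (first≥ w)
    yw≡ : y w ≡ n
    yw≡ = ≤-antisym (first≤ w<k) (≮⇒≥ y≮n)
    pieces : Convex k (suc a) → Convex (suc a) n → Convex a (2 + a)
    pieces left right with k <? a
    ... | yes k<a with inner {k} {suc a} (≤-refl , <⇒≤ sa<n , inj₂ sa<n) (s≤s k<a)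
    ...   | inj₁ (c , d , k<c , c<a , a<d , d≤n , g) = trim a (<⇒≤ k<c , d≤n , inj₁ k<c) (s≤s⁻¹ c<a) a<d g
    ...   | inj₂ (c , d , k≤c , c<k , _) = contradiction k≤c (<⇒≱ c<k)
    pieces left right | no k≮a with 2 + a <? n
    ...   | no n≤ = subst₂ Convex (trans xw≡ (≤-antisym k≤a (≮⇒≥ k≮a))) (trans yw≡ (≤-antisym (≮⇒≥ n≤) sa<n)) (E w)
    ...   | yes sa+1<n with inner {suc a} {n} (m≤n⇒m≤1+n k≤a , ≤-refl , inj₁ (s≤s k≤a)) sa+1<n
    ...     | inj₁ (c , d , _ , _ , n<d , d≤n , _) = contradiction d≤n (<⇒≱ n<d)
    ...     | inj₂ (c , d , k≤c , c<a , a<d , d<n , g) = trim a (k≤c , <⇒≤ d<n , inj₂ d<n) (s≤s⁻¹ c<a) a<d g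
    finish : ∃[ u ] (u < k × (x u ≡ suc a ⊎ y u ≡ suc a)) → Convex a (2 + a)
    finish (u , u<k , inj₁ xu≡) = pieces
      (subst₂ Convex xw≡ xu≡ (difference-left w<k u<k xw<xu yu≡yw))
      (subst₂ Convex xu≡ (trans yu≡yw yw≡) (E u))
      where
      xw<xu : x w < x u
      xw<xu = subst (x w <_) (sym xu≡) xw<a
      yu≡yw : y u ≡ y w
      yu≡yw = ≤-antisym (≤-trans (first≤ u<k) (≮⇒≥ y≮n)) (y-mono (<⇒≤ (x-reflect xw<xu)))
    finish (u , u<k , inj₂ yu≡) = pieces
      (subst₂ Convex (trans xu≡xw xw≡) yu≡ (E u))
      (subst₂ Convex yu≡ yw≡ (difference-right w<k u<k xu≡xw yu<yw))
      where
      yu<yw : y u < y w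
      yu<yw = subst (_< y w) (sym yu≡) a<yw
      xu≡xw : x u ≡ x w
      xu≡xw = ≤-antisym (x-mono (<⇒≤ (y-reflect yu<yw))) (≤-trans (≮⇒≥ k≮x) (first≥ u))

  inner-link : ∀ a → k ≤ a → suc a < n → Follow τ (at a) (at (suc a)) ⊎ Follow τ (at (suc a)) (at a)
  inner-link a k≤a sa<n = pair-next a 2≤n (inner-pair a k≤a sa<n)

-- Joining two paths into one circle

-- Succession is a single cycle; this is what forbids one path from closing up on its own.
follow-full : ∀ {n} (τ : CircOrd n) (S : Fin n → Set) →
  (∀ {u w} → Follow τ u w → S u → S w) → (∀ {u w} → Follow τ u w → S w → S u) → ∀ {u v} → S u → S v
follow-full {n} τ S forth back {u} {v} s =
  subst S (there v) (up (toℕ (to v)) (toℕ<n (to v)) (down (toℕ (to u)) (toℕ<n (to u)) (subst S (sym (there u)) s)))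
  where
  open Inverse τ
  0<n : 0 < n
  0<n = ≤-<-trans z≤n (toℕ<n (to u))
  there : ∀ v → from (fromℕ< (toℕ<n (to v))) ≡ v
  there v = trans (cong from (toℕ-injective (toℕ-fromℕ< _))) (strictlyInverseʳ v)
  consecutive : ∀ {i} (h : suc i < n) (h′ : i < n) → Follow τ (from (fromℕ< h′)) (from (fromℕ< h))
  consecutive h h′ = subst₂ Next (sym (strictlyInverseˡ _)) (sym (strictlyInverseˡ _))
    (inj₁ (trans (toℕ-fromℕ< h) (cong suc (sym (toℕ-fromℕ< h′)))))
  down : ∀ i (h : i < n) → S (from (fromℕ< h)) → S (from (fromℕ< 0<n))
  down zero h s = s
  down (suc i) h s = down i (<-trans (n<1+n i) h) (back (consecutive h (<-trans (n<1+n i) h)) s)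
  up : ∀ i (h : i < n) → S (from (fromℕ< 0<n)) → S (from (fromℕ< h))
  up zero h s = s
  up (suc i) h s = forth (consecutive h (<-trans (n<1+n i) h)) (up i (<-trans (n<1+n i) h) s)

-- `F` is abstract so that it can be the successor relation of τ or its converse, which covers both
-- orientations.
module Join {n : ℕ} (L : Listing n) (k₁ n₁ : ℕ) (n≡ : suc n₁ ≡ n) (k<n : suc k₁ < n)
    (F : Fin n → Fin n → Set)
    (functional : ∀ {u w w′} → F u w → F u w′ → w ≡ w′)
    (injective : ∀ {u u′ w} → F u w → F u′ w → u ≡ u′)
    (total : ∀ u → ∃[ w ] F u w)
    (full : ∀ (S : Fin n → Set) → (∀ {u w} → F u w → S u → S w) → (∀ {u w} → F u w → S w → S u) → ∀ {u v} → S u → S v)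
    (first-part : ∀ i → suc i < suc k₁ → F (Listing.seq L i) (Listing.seq L (suc i)))
    (second-part : ∀ i → suc k₁ ≤ i → suc i < n → F (Listing.seq L i) (Listing.seq L (suc i))) where
  open Listing L

  private
    k : ℕ
    k = suc k₁

    0<n : 0 < n
    0<n = ≤-<-trans z≤n k<n

    k₁<n : k₁ < n
    k₁<n = <-trans (n<1+n k₁) k<n

    n₁<n : n₁ < n
    n₁<n = ≤-reflexive n≡

  -- Every vertex other than the two path starts already has its predecessor inside a path.
  exit : ∀ {a} → a < n → suc a ≡ k ⊎ suc a ≡ n → F (seq a) (seq 0) ⊎ F (seq a) (seq k)
  exit {a} a<n end with total (seq a)
  ... | w , f = locate (index w) (index< w) (subst (F (seq a)) (sym (seq-index w)) f)
    where
    locate : ∀ j → j < n → F (seq a) (seq j) → F (seq a) (seq 0) ⊎ F (seq a) (seq k)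
    locate zero j<n f = inj₁ f
    locate (suc i) j<n f with <-cmp (suc i) k
    ... | tri≈ _ refl _ = inj₂ f
    ... | tri< h _ _ with seq-inj′ a<n (<-trans (n<1+n i) j<n) (injective f (first-part i h))
    ...   | refl = contradiction end [ <⇒≢ h , <⇒≢ j<n ]′
    locate (suc i) j<n f | tri> _ _ h with seq-inj′ a<n (<-trans (n<1+n i) j<n) (injective f (second-part i (s≤s⁻¹ h) j<n))
    ...   | refl = contradiction end [ >⇒≢ h , <⇒≢ j<n ]′

  -- Closing the first path would make it a proper part closed under `F` both ways.
  not-closed : ¬ F (seq k₁) (seq 0)
  not-closed f with full S forth back {seq 0} {seq k} (0 , s≤s z≤n , refl)
    where
    S : Fin n → Set
    S u = ∃[ i ] (i < k × seq i ≡ u)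
    forth : ∀ {u w} → F u w → S u → S w
    forth g (i , i<k , refl) with m≤n⇒m<n∨m≡n i<k
    ... | inj₁ h = suc i , h , functional (first-part i h) g
    ... | inj₂ refl = 0 , s≤s z≤n , functional f g
    back : ∀ {u w} → F u w → S w → S u
    back g (zero , i<k , refl) = k₁ , n<1+n k₁ , injective f g
    back g (suc i , i<k , refl) = i , <-trans (n<1+n i) i<k , injective (first-part i i<k) g
  ... | i , i<k , eq = seq-inj i<k k<n eq

  joint : F (seq k₁) (seq k)
  joint = [ (λ f → contradiction f not-closed) , (λ f → f) ]′ (exit k₁<n (inj₁ refl))

  closing : F (seq n₁) (seq 0)
  closing = [ (λ f → f) , (λ f → contradiction (trans (sym n≡) (cong suc (seq-inj′ n₁<n k₁<n (injective f joint)))) (>⇒≢ k<n)) ]′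
    (exit n₁<n (inj₂ n≡))

  follows : ∀ {u w} → Follow order u w → F u w
  follows h with follow-seq⁻ h
  ... | inj₂ (i , i≡ , refl , refl) = subst (λ i → F (seq i) (seq 0)) (suc-injective (trans n≡ (sym i≡))) closing
  ... | inj₁ (i , i<n , refl , refl) with <-cmp (suc i) k
  ... | tri< h _ _ = first-part i h
  ... | tri≈ _ refl _ = joint
  ... | tri> _ _ h = second-part i (s≤s⁻¹ h) i<n

-- The two tight orderings and their completeness

-- Each closed neighbourhood is the complement of an interval [c, d) of the listing.
module TightListing {n : ℕ} {G : Graph n} (L : Listing n) (c d : Fin n → ℕ)
    (c<d : ∀ v → c v < d v) (d≤n : ∀ v → d v ≤ n) (inside : ∀ v → 0 < c v ⊎ d v < n)
    (far : ∀ v {j} → j < n → c v ≤ j → j < d v → ¬ (N[ v ] G) (Listing.seq L j))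
    (near : ∀ v {j} → j < n → j < c v ⊎ d v ≤ j → (N[ v ] G) (Listing.seq L j))
    (share : ∀ u v → c u ≤ c v → d v ≤ d u → c u ≡ c v ⊎ d u ≡ d v) where
  open Listing L

  private
    P : Fin n → Fin n → Set
    P v = posSet order (N[ v ] G)

    position : ∀ {j} → j < n → Fin n
    position h = fromℕ< h

    P-near : ∀ v {j} (h : j < n) → j < c v ⊎ d v ≤ j → P v (position h)
    P-near v h out = subst (λ i → (N[ v ] G) (seq i)) (sym (toℕ-fromℕ< h)) (near v h out)

    P-far : ∀ v {j} (h : j < n) → c v ≤ j → j < d v → ¬ P v (position h)
    P-far v h c≤j j<d p = far v h c≤j j<d (subst (λ i → (N[ v ] G) (seq i)) (toℕ-fromℕ< h) p)

  arc : ArcOrdering G order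
  arc v = c v , d v , <⇒≤ (c<d v) , d≤n v , inj₂ λ p →
    mk⇔ (λ h (c≤p , p<d) → far v (toℕ<n p) c≤p p<d h)
        (λ out → near v (toℕ<n p) (side p out))
    where
    side : ∀ p → ¬ InInterval (c v) (d v) p → toℕ p < c v ⊎ d v ≤ toℕ p
    side p out with toℕ p <? c v
    ... | yes h = inj₁ h
    ... | no h = inj₂ (≮⇒≥ λ k → out (≮⇒≥ h , k))

  Shared : Fin n → Fin n → Set
  Shared u v = ∃[ p ] (Endpoint (P u) p × Endpoint (P v) p)

  shared-end : ∀ u v p q → Next p q ⊎ Next q p → P u p → P v p → ¬ P u q → ¬ P v q → Shared u v
  shared-end u v p q (inj₁ next) pu pv qu qv = p , (pu , inj₂ (qu ∘ subst (P u) (next-sucC next)))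
                                                 , (pv , inj₂ (qv ∘ subst (P v) (next-sucC next)))
  shared-end u v p q (inj₂ next) pu pv qu qv = p , (pu , inj₁ (qu ∘ subst (P u) (next-predC next)))
                                                 , (pv , inj₁ (qv ∘ subst (P v) (next-predC next)))

  next-position : ∀ {i} (h : i < n) (h′ : suc i < n) → Next (position h) (position h′)
  next-position h h′ = inj₁ (trans (toℕ-fromℕ< h′) (cong suc (sym (toℕ-fromℕ< h))))

  next-wrap : ∀ {i} (h : i < n) (h′ : 0 < n) → suc i ≡ n → Next (position h) (position h′)
  next-wrap h h′ eq = inj₂ (toℕ-fromℕ< h′ , trans (cong suc (toℕ-fromℕ< h)) eq)

  0<n : ∀ (v : Fin n) → 0 < n
  0<n v = ≤-<-trans z≤n (toℕ<n v)

  -- The shared endpoint is the position just before the common start. For start 0 this is the last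
  -- position, which `inside` keeps out of both intervals.
  shared-c : ∀ u v → c u ≡ c v → d v ≤ d u → Shared u v
  shared-c u v eq dv≤du = go (c u) refl
    where
    c<n : c u < n
    c<n = <-≤-trans (c<d u) (d≤n u)
    out-u = P-far u c<n ≤-refl (c<d u)
    out-v = P-far v c<n (≤-reflexive (sym eq)) (subst (_< d v) (sym eq) (c<d v))
    wrap : ∀ m (eq′ : suc m ≡ n) → c u ≡ 0 → Shared u v
    wrap m eq′ cu≡0 = shared-end u v (position m<n) (position c<n) (inj₁ next)
      (P-near u m<n (inj₂ du≤m)) (P-near v m<n (inj₂ (≤-trans dv≤du du≤m))) out-u out-v
      where
      m<n : m < n
      m<n = ≤-reflexive eq′
      du≤m : d u ≤ m
      du≤m = s≤s⁻¹ (subst (d u <_) (sym eq′) ([ (λ h → contradiction cu≡0 (>⇒≢ h)) , (λ h → h) ]′ (inside u)))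
      next : Next (position m<n) (position c<n)
      next = inj₂ (trans (toℕ-fromℕ< c<n) cu≡0 , trans (cong suc (toℕ-fromℕ< m<n)) eq′)
    go : ∀ i → c u ≡ i → Shared u v
    go zero cu≡ = wrap (pred n) (suc-pred n ⦃ >-nonZero (0<n u) ⦄) cu≡
    go (suc i) cu≡ = shared-end u v (position i<n) (position c<n)
      (inj₁ (inj₁ (trans (toℕ-fromℕ< c<n) (trans cu≡ (cong suc (sym (toℕ-fromℕ< i<n)))))))
      (P-near u i<n (inj₁ i<c)) (P-near v i<n (inj₁ (subst (i <_) eq i<c))) out-u out-v
      where
      i<c : i < c u
      i<c = ≤-reflexive (sym cu≡)
      i<n : i < n
      i<n = <-trans i<c c<n

  shared-d : ∀ u v → d u ≡ d v → c u ≤ c v → Shared u v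
  shared-d u v eq cu≤cv = go (d u) refl
    where
    go : ∀ i → d u ≡ i → Shared u v
    go zero du≡ = contradiction (subst (c u <_) du≡ (c<d u)) λ ()
    go (suc i) du≡ = after
      where
      i<du : i < d u
      i<du = ≤-reflexive (sym du≡)
      i<n : i < n
      i<n = <-≤-trans i<du (d≤n u)
      out-u = P-far u i<n (s≤s⁻¹ (subst (c u <_) du≡ (c<d u))) i<du
      out-v = P-far v i<n (s≤s⁻¹ (subst (c v <_) (trans (sym eq) du≡) (c<d v))) (subst (i <_) eq i<du)
      after : Shared u v
      after with suc i <? n
      ... | yes h = shared-end u v (position h) (position i<n) (inj₂ (next-position i<n h))
          (P-near u h (inj₂ (≤-reflexive du≡))) (P-near v h (inj₂ (≤-reflexive (trans (sym eq) du≡)))) out-u out-v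
      ... | no h = shared-end u v (position (0<n u)) (position i<n) (inj₂ (next-wrap i<n (0<n u) i≡))
          (P-near u (0<n u) (inj₁ 0<cu)) (P-near v (0<n u) (inj₁ (<-≤-trans 0<cu cu≤cv))) out-u out-v
        where
        i≡ : suc i ≡ n
        i≡ = ≤-antisym i<n (≮⇒≥ h)
        0<cu : 0 < c u
        0<cu = [ (λ k → k) , (λ k → contradiction (trans du≡ i≡) (<⇒≢ k)) ]′ (inside u)

  tight : TightArcOrdering G order
  tight = arc , λ u v u⊆v _ → [ (λ eq → shared-c u v eq (d≥ u v u⊆v)) , (λ eq → shared-d u v eq (c≥ u v u⊆v)) ]′
      (share u v (c≥ u v u⊆v) (d≥ u v u⊆v))
    where
    within : ∀ u v → (∀ w → (N[ u ] G) w → (N[ v ] G) w) → ∀ {j} → c v ≤ j → j < d v → c u ≤ j × j < d u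
    within u v u⊆v {j} c≤j j<d =
      ≮⇒≥ (λ h → far v j<n c≤j j<d (u⊆v _ (near u j<n (inj₁ h)))) , ≰⇒> (λ h → far v j<n c≤j j<d (u⊆v _ (near u j<n (inj₂ h))))
      where
      j<n : j < n
      j<n = <-≤-trans j<d (d≤n v)
    c≥ : ∀ u v → (∀ w → (N[ u ] G) w → (N[ v ] G) w) → c u ≤ c v
    c≥ u v u⊆v = proj₁ (within u v u⊆v ≤-refl (c<d v))
    d≥ : ∀ u v → (∀ w → (N[ u ] G) w → (N[ v ] G) w) → d v ≤ d u
    d≥ u v u⊆v = go (d v) refl
      where
      go : ∀ i → d v ≡ i → d v ≤ d u
      go zero eq = ≤-trans (≤-reflexive eq) z≤n
      go (suc i) eq = ≤-trans (≤-reflexive eq) (proj₂ (within u v u⊆v (s≤s⁻¹ (subst (c v <_) eq (c<d v))) (≤-reflexive (sym eq))))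

module TwoOrders {n : ℕ} {G : Graph n} (T : TwoSided G) where
  open TwoSided T

  straight : Listing n
  straight = CycleOrder.listing cycle

  data Straight (i c d : ℕ) : Set where
    first : i < k → x i ≡ c → y i ≡ d → Straight i c d
    second : k ≤ i → i < n → x i ≡ c + n → y i ≡ d + n → Straight i c d

  -- Reversing the second side sends the gap `g` to `k + n - g` and so exchanges the two ends of an
  -- interval there; sums avoid truncated subtraction. Intervals in the first side do not move.
  data Turned (i c d : ℕ) : Set where
    first : i < k → c + y i ≡ k + n → d + x i ≡ k + n → Turned i c d
    second : k ≤ i → i < n → x i ≡ c + n → y i ≡ d + n → Turned i c d

  far-second : ∀ {i c d} → x i ≡ c + n → y i ≡ d + n → ∀ {j} → c ≤ j → j < d → ¬ (N[ at i ] G) (at j)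
  far-second {i} x≡ y≡ {j} c≤j j<d h = far (subst (_≤ j + n) (sym x≡) (+-monoˡ-≤ n c≤j))
    (subst (j + n <_) (sym y≡) (+-monoˡ-< n j<d)) (subst (N[ at i ] G) (sym (at-per j)) h)

  d≤k-second : ∀ {i d} → i < n → y i ≡ d + n → d ≤ k
  d≤k-second i<n y≡ = +-cancelʳ-≤ n _ _ (subst (_≤ k + n) y≡ (second≤ i<n))

  near-second : ∀ {i c d} → i < n → x i ≡ c + n → y i ≡ d + n → ∀ {j} → j < n → j < c ⊎ d ≤ j → (N[ at i ] G) (at j)
  near-second {i} {c} {d} i<n x≡ y≡ {j} j<n (inj₁ j<c) = subst (N[ at i ] G) (trans (at-per (j + n)) (at-per j))
    (near (subst (_≤ j + n + n) (sym y≡) (+-monoˡ-≤ n (≤-trans (d≤k-second i<n y≡) (≤-trans (<⇒≤ k<n) (m≤n+m n j)))))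
          (+-monoˡ-< n (subst (j + n <_) (sym x≡) (+-monoˡ-< n j<c))))
  near-second {i} {c} i<n x≡ y≡ {j} j<n (inj₂ d≤j) = subst (N[ at i ] G) (at-per j)
    (near (subst (_≤ j + n) (sym y≡) (+-monoˡ-≤ n d≤j))
          (+-monoˡ-< n (<-≤-trans j<n (subst (n ≤_) (sym x≡) (m≤n+m n c)))))

  near-first : ∀ {i} → i < k → ∀ {j} → j < n → j < x i ⊎ y i ≤ j → (N[ at i ] G) (at j)
  near-first {i} i<k {j} j<n (inj₁ j<x) = subst (N[ at i ] G) (at-per j) (near (≤-trans (first≤ i<k) (m≤n+m n j)) (+-monoˡ-< n j<x))
  near-first i<k j<n (inj₂ y≤j) = near y≤j (<-≤-trans j<n (m≤n+m n _))

  c<d-second : ∀ {i c d} → x i ≡ c + n → y i ≡ d + n → c < d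
  c<d-second x≡ y≡ = +-cancelʳ-< n _ _ (subst₂ _<_ x≡ y≡ (x<y _))

  -- `x` and `y` move in the same direction, so nesting forces agreement at one end. This is the
  -- source of tightness for both orderings.
  share-xy : ∀ {i j} → x i ≤ x j → y j ≤ y i → x i ≡ x j ⊎ y i ≡ y j
  share-xy {i} {j} x≤ y≤ with ≤-total i j
  ... | inj₁ i≤j = inj₂ (≤-antisym (y-mono i≤j) y≤)
  ... | inj₂ j≤i = inj₁ (≤-antisym x≤ (x-mono j≤i))

  share-second : ∀ {i j c d c′ d′} → x i ≡ c + n → y i ≡ d + n → x j ≡ c′ + n → y j ≡ d′ + n →
                 c ≤ c′ → d′ ≤ d → c ≡ c′ ⊎ d ≡ d′
  share-second x≡ y≡ x≡′ y≡′ c≤ d≤ = map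
    (λ e → +-cancelʳ-≡ n _ _ (trans (sym x≡) (trans e x≡′)))
    (λ e → +-cancelʳ-≡ n _ _ (trans (sym y≡) (trans e y≡′)))
    (share-xy (subst₂ _≤_ (sym x≡) (sym x≡′) (+-monoˡ-≤ n c≤)) (subst₂ _≤_ (sym y≡′) (sym y≡) (+-monoˡ-≤ n d≤)))

  module StraightSpan where

    bounds : ∀ {i} → i < n → ∃[ c ] ∃[ d ] Straight i c d
    bounds {i} i<n with i <? k
    ... | yes i<k = x i , y i , first i<k refl refl
    ... | no i≮k = x i ∸ n , y i ∸ n , second (≮⇒≥ i≮k) i<n
      (sym (m∸n+n≡m (second≥ (≮⇒≥ i≮k)))) (sym (m∸n+n≡m (≤-trans (second≥ (≮⇒≥ i≮k)) (x≤y i))))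

    c<d : ∀ {i c d} → Straight i c d → c < d
    c<d (first i<k refl refl) = x<y _
    c<d (second k≤i i<n x≡ y≡) = c<d-second x≡ y≡

    d≤n : ∀ {i c d} → Straight i c d → d ≤ n
    d≤n (first i<k refl refl) = first≤ i<k
    d≤n (second k≤i i<n x≡ y≡) = ≤-trans (d≤k-second i<n y≡) (<⇒≤ k<n)

    inside : ∀ {i c d} → Straight i c d → 0 < c ⊎ d < n
    inside (first i<k refl refl) = inj₁ (<-≤-trans 0<k (first≥ _))
    inside (second k≤i i<n x≡ y≡) = inj₂ (≤-<-trans (d≤k-second i<n y≡) k<n)

    far-in : ∀ {i c d} → Straight i c d → ∀ {j} → c ≤ j → j < d → ¬ (N[ at i ] G) (at j)
    far-in (first i<k refl refl) = far
    far-in (second k≤i i<n x≡ y≡) = far-second x≡ y≡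

    near-out : ∀ {i c d} → Straight i c d → ∀ {j} → j < n → j < c ⊎ d ≤ j → (N[ at i ] G) (at j)
    near-out (first i<k refl refl) = near-first i<k
    near-out (second k≤i i<n x≡ y≡) = near-second i<n x≡ y≡

    share : ∀ {i j c d c′ d′} → Straight i c d → Straight j c′ d′ → c ≤ c′ → d′ ≤ d → c ≡ c′ ⊎ d ≡ d′
    share (first _ refl refl) (first _ refl refl) c≤ d≤ = share-xy c≤ d≤
    share (second _ _ x≡ y≡) (second _ _ x≡′ y≡′) c≤ d≤ = share-second x≡ y≡ x≡′ y≡′ c≤ d≤
    share (first _ refl refl) s@(second _ i<n x≡ y≡) c≤ d≤ =
      contradiction (≤-trans (first≥ _) c≤) (<⇒≱ (<-≤-trans (c<d s) (d≤k-second i<n y≡)))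
    share (second _ i<n x≡ y≡) s@(first _ refl refl) c≤ d≤ =
      contradiction (≤-trans d≤ (d≤k-second i<n y≡)) (<⇒≱ (≤-<-trans (first≥ _) (c<d s)))

  -- The position of at j after the second side is reversed.
  turn : ℕ → ℕ
  turn j with j <? k
  ... | yes _ = j
  -- Positions are reflected with a `suc`, gaps without: `k` and `n - 1` are exchanged.
  ... | no _ = k + n ∸ suc j

  turn-first : ∀ {j} → j < k → turn j ≡ j
  turn-first {j} j<k with j <? k
  ... | yes _ = refl
  ... | no j≮k = contradiction j<k j≮k

  turn-second : ∀ {j} → k ≤ j → j < n → suc j + turn j ≡ k + n
  turn-second {j} k≤j j<n with j <? k
  ... | yes j<k = contradiction k≤j (<⇒≱ j<k)
  ... | no _ = m+[n∸m]≡n (≤-trans j<n (m≤n+m n k))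

  turn-second≥ : ∀ {j} → k ≤ j → j < n → k ≤ turn j
  turn-second≥ {j} k≤j j<n = +-cancelˡ-≤ n k (turn j)
    (subst₂ _≤_ (+-comm k n) refl (≤-trans (≤-reflexive (sym (turn-second k≤j j<n))) (+-monoˡ-≤ (turn j) j<n)))

  turn-second< : ∀ {j} → k ≤ j → j < n → turn j < n
  turn-second< {j} k≤j j<n = +-cancelˡ-≤ k (suc (turn j)) n
    (≤-trans (+-monoˡ-≤ (suc (turn j)) k≤j) (≤-reflexive (trans (+-suc j (turn j)) (turn-second k≤j j<n))))

  turn< : ∀ {j} → j < n → turn j < n
  turn< {j} j<n with k ≤? j
  ... | yes k≤j = turn-second< k≤j j<n
  ... | no k≰j = subst (_< n) (sym (turn-first (≰⇒> k≰j))) j<n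

  turn-involutive : ∀ {j} → j < n → turn (turn j) ≡ j
  turn-involutive {j} j<n with k ≤? j
  ... | no k≰j = trans (cong turn (turn-first (≰⇒> k≰j))) (turn-first (≰⇒> k≰j))
  ... | yes k≤j = +-cancelˡ-≡ (suc (turn j)) (turn (turn j)) j (trans (turn-second (turn-second≥ k≤j j<n) (turn-second< k≤j j<n))
      (trans (sym (turn-second k≤j j<n)) (cong suc (+-comm j (turn j)))))

  turned : Listing n
  turned = record
    { seq = λ j → at (turn j)
    ; seq-inj = λ {i} {j} i<j j<n eq → <⇒≢ i<j (trans (sym (turn-involutive (<-trans i<j j<n)))
        (trans (cong turn (at-inj′ z≤n (turn< (<-trans i<j j<n)) z≤n (turn< j<n) eq)) (turn-involutive j<n)))
    ; index = λ u → turn (index u) ; index< = λ u → turn< (index< u)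
    ; seq-index = λ u → trans (cong at (turn-involutive (index< u))) (at-index u) }

  module TurnedSpan where

    bounds : ∀ {i} → i < n → ∃[ c ] ∃[ d ] Turned i c d
    bounds {i} i<n with i <? k
    ... | yes i<k = k + n ∸ y i , k + n ∸ x i , first i<k (m∸n+n≡m y≤k+n) (m∸n+n≡m (≤-trans (x≤y i) y≤k+n))
      where
      y≤k+n : y i ≤ k + n
      y≤k+n = ≤-trans (first≤ i<k) (m≤n+m n k)
    ... | no i≮k = x i ∸ n , y i ∸ n , second (≮⇒≥ i≮k) i<n
      (sym (m∸n+n≡m (second≥ (≮⇒≥ i≮k)))) (sym (m∸n+n≡m (≤-trans (second≥ (≮⇒≥ i≮k)) (x≤y i))))

    balance-≤ : ∀ {a b a′ b′} → a + b ≡ k + n → a′ + b′ ≡ k + n → a ≤ a′ → b′ ≤ b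
    balance-≤ {a} {b} {a′} {b′} eq eq′ a≤ = +-cancelˡ-≤ a b′ b
      (≤-trans (+-monoˡ-≤ b′ a≤) (≤-reflexive (trans eq′ (sym eq))))

    balance-< : ∀ {a b a′ b′} → a + b ≡ k + n → a′ + b′ ≡ k + n → a < a′ → b′ < b
    balance-< {a} {b} {a′} {b′} eq eq′ a< = +-cancelˡ-< a b′ b
      (<-≤-trans (+-monoˡ-< b′ a<) (≤-reflexive (trans eq′ (sym eq))))

    balance-≤ʳ : ∀ {a b a′ b′} → a + b ≡ k + n → a′ + b′ ≡ k + n → b ≤ b′ → a′ ≤ a
    balance-≤ʳ {a} {b} {a′} {b′} eq eq′ b≤ = balance-≤ (trans (+-comm b a) eq) (trans (+-comm b′ a′) eq′) b≤

    balance-<ʳ : ∀ {a b a′ b′} → a + b ≡ k + n → a′ + b′ ≡ k + n → b < b′ → a′ < a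
    balance-<ʳ {a} {b} {a′} {b′} eq eq′ b< = balance-< (trans (+-comm b a) eq) (trans (+-comm b′ a′) eq′) b<

    k≤c : ∀ {i c} → i < k → c + y i ≡ k + n → k ≤ c
    k≤c i<k eq = balance-≤ʳ eq refl (first≤ i<k)

    c<d : ∀ {i c d} → Turned i c d → c < d
    c<d (first i<k c≡ d≡) = balance-<ʳ d≡ c≡ (x<y _)
    c<d (second k≤i i<n x≡ y≡) = c<d-second x≡ y≡

    d≤n : ∀ {i c d} → Turned i c d → d ≤ n
    d≤n {i} {c} {d} (first i<k c≡ d≡) = balance-≤ʳ (+-comm n k) d≡ (first≥ i)
    d≤n (second k≤i i<n x≡ y≡) = ≤-trans (d≤k-second i<n y≡) (<⇒≤ k<n)

    inside : ∀ {i c d} → Turned i c d → 0 < c ⊎ d < n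
    inside (first i<k c≡ d≡) = inj₁ (<-≤-trans 0<k (k≤c i<k c≡))
    inside (second k≤i i<n x≡ y≡) = inj₂ (≤-<-trans (d≤k-second i<n y≡) k<n)

    far-in : ∀ {i c d} → Turned i c d → ∀ {j} → j < n → c ≤ j → j < d → ¬ (N[ at i ] G) (at (turn j))
    far-in {i} (first i<k c≡ d≡) {j} j<n c≤j j<d = far
      (balance-≤ (turn-second k≤j j<n) d≡ j<d)
      (balance-≤ c≡ (trans (+-suc j (turn j)) (turn-second k≤j j<n)) c≤j)
      where
      k≤j : k ≤ j
      k≤j = ≤-trans (k≤c i<k c≡) c≤j
    far-in {i} (second k≤i i<n x≡ y≡) {j} j<n c≤j j<d h = far-second x≡ y≡ c≤j j<d
      (subst (λ l → (N[ at i ] G) (at l)) (turn-first (<-≤-trans j<d (d≤k-second i<n y≡))) h)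

    near-out : ∀ {i c d} → Turned i c d → ∀ {j} → j < n → j < c ⊎ d ≤ j → (N[ at i ] G) (at (turn j))
    near-out {i} (first i<k c≡ d≡) {j} j<n out with k ≤? j
    ... | no k≰j = near-first i<k (turn< j<n) (inj₁ (subst (_< x i) (sym (turn-first (≰⇒> k≰j))) (<-≤-trans (≰⇒> k≰j) (first≥ i))))
    ... | yes k≤j with out
    ... | inj₁ j<c = near-first i<k (turn< j<n) (inj₂ (balance-≤ (turn-second k≤j j<n) c≡ j<c))
    ... | inj₂ d≤j = near-first i<k (turn< j<n) (inj₁ (balance-≤ d≡ (trans (+-suc j (turn j)) (turn-second k≤j j<n)) d≤j))
    near-out {i} (second k≤i i<n x≡ y≡) {j} j<n out with k ≤? j
    ... | no k≰j = subst (λ l → (N[ at i ] G) (at l)) (sym (turn-first (≰⇒> k≰j))) (near-second i<n x≡ y≡ j<n out)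
    ... | yes k≤j = near-second i<n x≡ y≡ (turn< j<n) (inj₂ (≤-trans (d≤k-second i<n y≡) (turn-second≥ k≤j j<n)))

    share : ∀ {i j c d c′ d′} → Turned i c d → Turned j c′ d′ → c ≤ c′ → d′ ≤ d → c ≡ c′ ⊎ d ≡ d′
    share {i} {j} {c} {d} {c′} {d′} (first _ c≡ d≡) (first _ c≡′ d≡′) c≤ d≤ =
      [ (λ e → inj₂ (+-cancelʳ-≡ (x i) d d′ (trans d≡ (trans (sym d≡′) (cong (d′ +_) (sym e))))))
      , (λ e → inj₁ (+-cancelʳ-≡ (y i) c c′ (trans c≡ (trans (sym c≡′) (cong (c′ +_) (sym e)))))) ]′
      (share-xy (balance-≤ d≡′ d≡ d≤) (balance-≤ c≡ c≡′ c≤))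
    share (second _ _ x≡ y≡) (second _ _ x≡′ y≡′) c≤ d≤ = share-second x≡ y≡ x≡′ y≡′ c≤ d≤
    share (first i<k c≡ _) s@(second _ i<n x≡ y≡) c≤ d≤ =
      contradiction (≤-trans (k≤c i<k c≡) c≤) (<⇒≱ (<-≤-trans (c<d s) (d≤k-second i<n y≡)))
    share (second _ i<n x≡ y≡) s@(first i<k c≡ _) c≤ d≤ =
      contradiction (≤-trans d≤ (d≤k-second i<n y≡)) (<⇒≱ (≤-<-trans (k≤c i<k c≡) (c<d s)))

  σ₁ σ₂ : CircOrd n
  σ₁ = Listing.order straight
  σ₂ = Listing.order turned

  private
    N-at : ∀ v {w} → (N[ v ] G) w → (N[ at (index v) ] G) w
    N-at v {w} = subst (λ u → (N[ u ] G) w) (sym (at-index v))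

    at-N : ∀ v {w} → (N[ at (index v) ] G) w → (N[ v ] G) w
    at-N v {w} = subst (λ u → (N[ u ] G) w) (at-index v)

  tight₁ : TightArcOrdering G σ₁
  tight₁ = TightListing.tight {G = G} straight (λ v → proj₁ (b v)) (λ v → proj₁ (proj₂ (b v)))
    (λ v → c<d (s v)) (λ v → d≤n (s v)) (λ v → inside (s v))
    (λ v _ c≤j j<d h → far-in (s v) c≤j j<d (N-at v h)) (λ v j<n out → at-N v (near-out (s v) j<n out))
    (λ u v → share (s u) (s v))
    where
    open StraightSpan
    b : ∀ v → ∃[ c ] ∃[ d ] Straight (index v) c d
    b v = bounds (index< v)
    s : ∀ v → Straight (index v) (proj₁ (b v)) (proj₁ (proj₂ (b v)))
    s v = proj₂ (proj₂ (b v))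

  tight₂ : TightArcOrdering G σ₂
  tight₂ = TightListing.tight {G = G} turned (λ v → proj₁ (b v)) (λ v → proj₁ (proj₂ (b v)))
    (λ v → c<d (s v)) (λ v → d≤n (s v)) (λ v → inside (s v))
    (λ v j<n c≤j j<d h → far-in (s v) j<n c≤j j<d (N-at v h)) (λ v j<n out → at-N v (near-out (s v) j<n out))
    (λ u v → share (s u) (s v))
    where
    open TurnedSpan
    b : ∀ v → ∃[ c ] ∃[ d ] Turned (index v) c d
    b v = bounds (index< v)
    s : ∀ v → Turned (index v) (proj₁ (b v)) (proj₁ (proj₂ (b v)))
    s v = proj₂ (proj₂ (b v))

  2+k≤n : 2 + k ≤ n
  2+k≤n = ≤-trans (+-monoˡ-≤ k (TwoSided.2≤k (exchange-sides T))) (≤-reflexive (m∸n+n≡m (<⇒≤ k<n)))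

  3≤n : 3 ≤ n
  3≤n = ≤-trans (s≤s (s≤s 0<k)) 2+k≤n

  module Different (k₂ n₁ : ℕ) (k≡ : 2 + k₂ ≡ k) (n≡ : suc n₁ ≡ n) where

    k<n₁ : k < n₁
    k<n₁ = s≤s⁻¹ (subst (2 + k ≤_) (sym n≡) 2+k≤n)

    n₁<n : n₁ < n
    n₁<n = ≤-reflexive n≡

    k₁<k : suc k₂ < k
    k₁<k = ≤-reflexive k≡

    after₁ : Follow σ₁ (at (suc k₂)) (at k)
    after₁ = subst (λ l → Follow σ₁ (at (suc k₂)) (at l)) k≡ (Listing.follow-seq straight (subst (_< n) (sym k≡) k<n))

    before₁ : Follow σ₁ (at k₂) (at (suc k₂))
    before₁ = Listing.follow-seq straight (<-trans k₁<k k<n)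

    after₂ : Follow σ₂ (at (suc k₂)) (at n₁)
    after₂ = subst₂ (λ i j → Follow σ₂ (at i) (at j)) (turn-first k₁<k) turn-k
      (Listing.follow-seq turned (subst (_< n) (sym k≡) k<n))
      where
      turn-k : turn (2 + k₂) ≡ n₁
      turn-k = trans (cong turn k≡) (+-cancelˡ-≡ (suc k) (turn k) n₁
        (trans (turn-second ≤-refl k<n) (trans (cong (k +_) (sym n≡)) (+-suc k n₁))))

    -- The last vertex of the first side is followed by `n₁` in σ₂, while its neighbours in σ₁ are
    -- `k₂` and `k`. These differ from `n₁` because the second side has at least two vertices.
    different : ¬ SameUpToReversal σ₁ σ₂
    different (inj₁ f) = <⇒≢ k<n₁ (at-inj′ z≤n k<n z≤n n₁<n
      (trans (sym (follow-succV σ₁ after₁)) (trans (sym (f _)) (follow-succV σ₂ after₂))))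
    different (inj₂ f) = <⇒≢ (<-trans (<-trans (n<1+n k₂) k₁<k) k<n₁) (at-inj′ z≤n k₂<n z≤n n₁<n
      (trans (sym (follow-predV σ₁ before₁)) (trans (sym (f _)) (follow-succV σ₂ after₂))))
      where
      k₂<n : k₂ < n
      k₂<n = <-trans (<-trans (n<1+n k₂) k₁<k) k<n

  module Unique (τ : CircOrd n) (tight : TightArcOrdering G τ) where
    open Paths 3≤n at at-inj τ

    second-links : ∀ a → k ≤ a → suc a < n → Fwd a ⊎ Bwd a
    second-links = TightOrder.inner-link T τ tight

    first-links : ∀ a → 0 ≤ a → suc a < k → Fwd a ⊎ Bwd a
    first-links a _ sa<k = subst₂ (λ u v → Follow τ u v ⊎ Follow τ v u) (at≡ a) (at≡ (suc a))
      -- In the exchanged numbering the first side occupies the positions from `n - k` to `n - 1`.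
      (TightOrder.inner-link (exchange-sides T) τ tight (a + (n ∸ k)) (m≤n+m (n ∸ k) a)
        (<-≤-trans (+-monoˡ-< (n ∸ k) sa<k) (≤-reflexive (m+[n∸m]≡n (<⇒≤ k<n)))))
      where
      at≡ : ∀ a → at (a + (n ∸ k) + k) ≡ at a
      at≡ a = trans (cong at (trans (+-assoc a (n ∸ k) k) (cong (a +_) (m∸n+n≡m (<⇒≤ k<n))))) (at-per a)

    module Cases (k₁ n₁ : ℕ) (k≡ : suc k₁ ≡ k) (n≡ : suc n₁ ≡ n) where

      module JoinFwd (L : Listing n) = Join L k₁ n₁ n≡ (subst (_< n) (sym k≡) k<n) (Follow τ)
        (follow-functional τ) (follow-injective τ) (λ u → succV τ u , succV-follow τ u) (follow-full τ)

      module JoinBwd (L : Listing n) = Join L k₁ n₁ n≡ (subst (_< n) (sym k≡) k<n) (λ u w → Follow τ w u)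
        (λ h h′ → follow-injective τ h h′) (λ h h′ → follow-functional τ h h′) (λ u → predV τ u , predV-follow τ u)
        (λ S forth back → follow-full τ S (λ h → back h) (λ h → forth h))

      in-first : ∀ (P : ℕ → ℕ → Set) → (∀ a → 0 ≤ a → suc a < k → P a (suc a)) →
                 ∀ i → suc i < suc k₁ → P (turn i) (turn (suc i))
      in-first P h i i<k = subst₂ P (sym (turn-first (<-trans (n<1+n i) si<k))) (sym (turn-first si<k)) (h i z≤n si<k)
        where
        si<k : suc i < k
        si<k = subst (suc i <_) k≡ i<k

      in-second : ∀ (P : ℕ → ℕ → Set) → (∀ a → k ≤ a → suc a < n → P (suc a) a) →
                  ∀ i → suc k₁ ≤ i → suc i < n → P (turn i) (turn (suc i))
      in-second P h i k≤i i<n = subst (λ l → P l (turn (suc i))) step≡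
        (h (turn (suc i)) (turn-second≥ (m≤n⇒m≤1+n k≤i′) i<n) (subst (_< n) (sym step≡) (turn< (<-trans (n<1+n i) i<n))))
        where
        k≤i′ : k ≤ i
        k≤i′ = subst (_≤ i) k≡ k≤i
        step≡ : suc (turn (suc i)) ≡ turn i
        step≡ = +-cancelˡ-≡ (suc i) (suc (turn (suc i))) (turn i) (trans (+-suc (suc i) (turn (suc i)))
          (trans (turn-second (m≤n⇒m≤1+n k≤i′) i<n) (sym (turn-second k≤i′ (<-trans (n<1+n i) i<n)))))

      from-k₁ : ∀ {P : ℕ → Set} → (∀ a → k ≤ a → suc a < n → P a) → ∀ i → suc k₁ ≤ i → suc i < n → P i
      from-k₁ h i k≤i = h i (subst (_≤ i) k≡ k≤i)

      to-k₁ : ∀ {P : ℕ → Set} → (∀ a → 0 ≤ a → suc a < k → P a) → ∀ i → suc i < suc k₁ → P i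
      to-k₁ h i i<k = h i z≤n (subst (suc i <_) k≡ i<k)

      -- Sides running the same way give σ₁, sides running opposite ways give σ₂. If the first side
      -- runs backwards, the join is made for the converse relation.
      unique : SameUpToReversal σ₁ τ ⊎ SameUpToReversal σ₂ τ
      unique with direction 0 k first-links 2≤k | direction k n second-links 2+k≤n
      ... | inj₁ f | inj₁ g = inj₁ (same-direction σ₁ τ (JoinFwd.follows straight (to-k₁ f) (from-k₁ g)))
      ... | inj₂ f | inj₂ g = inj₁ (opposite-direction σ₁ τ (JoinBwd.follows straight (to-k₁ f) (from-k₁ g)))
      ... | inj₁ f | inj₂ g = inj₂ (same-direction σ₂ τ (JoinFwd.follows turned
            (in-first (λ i j → Follow τ (at i) (at j)) f) (in-second (λ i j → Follow τ (at i) (at j)) g)))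
      ... | inj₂ f | inj₁ g = inj₂ (opposite-direction σ₂ τ (JoinBwd.follows turned
            (in-first (λ i j → Follow τ (at j) (at i)) f) (in-second (λ i j → Follow τ (at j) (at i)) g)))

  two-orders : ∃[ σ₁ ] ∃[ σ₂ ] (TightArcOrdering G σ₁ × TightArcOrdering G σ₂
    × ¬ SameUpToReversal σ₁ σ₂
    × (∀ τ → TightArcOrdering G τ → SameUpToReversal σ₁ τ ⊎ SameUpToReversal σ₂ τ))
  two-orders = σ₁ , σ₂ , tight₁ , tight₂
    , Different.different (k ∸ 2) (pred n) (m+[n∸m]≡n 2≤k) n≡
    , λ τ tight → Unique.Cases.unique τ tight (pred k) (pred n) (suc-pred k ⦃ >-nonZero 0<k ⦄) n≡
    where
    n≡ : suc (pred n) ≡ n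
    n≡ = suc-pred n ⦃ >-nonZero (<-trans 0<k k<n) ⦄

theorem3p7 : ∀ {n} (G : Graph n) → TwinFree G → Connected (Adj G) → PCA G →
    (¬ Bipartite (CoAdj G) →
    ∃[ σ ] (ArcOrdering G σ × (∀ τ → ArcOrdering G τ → SameUpToReversal σ τ)))
    × (Bipartite (CoAdj G) → Connected (CoAdj G) → 2 ≤ n →
    ∃[ σ₁ ] ∃[ σ₂ ] (TightArcOrdering G σ₁ × TightArcOrdering G σ₂
    × ¬ SameUpToReversal σ₁ σ₂
    × (∀ τ → TightArcOrdering G τ → SameUpToReversal σ₁ τ ⊎ SameUpToReversal σ₂ τ)))
theorem3p7 {n} G twin-free conn pca = part₁ , part₂
  where
  R : 2 ≤ n → Round G
  R 2≤n = round-of-PCA 2≤n twin-free pca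
  few-vertices : ∀ {n} → ¬ 2 ≤ n → ∀ (u v : Fin n) → u ≡ v
  few-vertices {suc zero} _ Fin.zero Fin.zero = refl
  few-vertices {suc (suc n)} n<2 _ _ = contradiction (s≤s (s≤s z≤n)) n<2
  part₁ : ¬ Bipartite (CoAdj G) → ∃[ σ ] (ArcOrdering G σ × (∀ τ → ArcOrdering G τ → SameUpToReversal σ τ))
  part₁ ¬bip with 2 ≤? n
  ... | yes 2≤n = RoundGraph.non-bipartite-case (R 2≤n) twin-free conn ¬bip
  ... | no n<2 = contradiction ((λ _ → true) , λ u v co → contradiction (few-vertices n<2 u v) (proj₁ co)) ¬bip
  part₂ : Bipartite (CoAdj G) → Connected (CoAdj G) → 2 ≤ n →
    ∃[ σ₁ ] ∃[ σ₂ ] (TightArcOrdering G σ₁ × TightArcOrdering G σ₂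
    × ¬ SameUpToReversal σ₁ σ₂
    × (∀ τ → TightArcOrdering G τ → SameUpToReversal σ₁ τ ⊎ SameUpToReversal σ₂ τ))
  part₂ bip coconn 2≤n = TwoOrders.two-orders (twoSided 2≤n twin-free conn coconn (R 2≤n) bip)
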